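{- Let $I$ be a finite set of positive integers with $\#I\ge2$, let $m=\max I$, $I^-=I\setminus\{m\}$, $m^-=\max I^-$, and $$\rho=\min\left(m!+1,\ (m!\cdot\#I)^{1/(m-m^-)}\right).$$ Then every complex root of $d(I;z)$ lies in the union of the discs $\mathcal D_k=\{z\in\mathbb C\mid |z-k|\le\rho\}$, $k=0,1,\dots,m-1$. In particular, if $d(I;z_0)=0$ then $|z_0|\le\rho+m-1$, $\mathrm{Re}(z_0)\ge-\rho$, and $|\mathrm{Im}(z_0)|\le\rho$.
   Context: $d(I;z)$ is the descent polynomial: the unique polynomial whose value at each integer $n>\max I$ is the number of permutations $\pi\in\mathfrak S_n$ with $\{j\mid\pi_j>\pi_{j+1}\}=I$, evaluated at complex $z$. -}

module Defs where

open import Algebra.Bundles using (CommutativeRing; Semiring)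
import Algebra.Construct.NaturalChoice.Max as NaturalMax
import Algebra.Construct.NaturalChoice.Min as NaturalMin
import Algebra.Definitions.RawSemiring as RawSemiringDefinitions
import Algebra.Properties.Ring as RingProperties
import Algebra.Solver.Ring.NaturalCoefficients.Default as SemiringSolver
open import Data.Bool.Base using (if_then_else_)
open import Data.Fin.Base using (Fin)
import Data.Fin.Properties as Fin
open import Data.List.Base
  using (List; []; _∷_; length; filter; cartesianProductWith; allFin)
import Data.List.Extrema.Nat as Extrema
import Data.List.Properties as List
open import Data.List.Relation.Unary.All as All using (All; []; _∷_)
import Data.List.Relation.Unary.All.Properties as All
open import Data.List.Relation.Unary.Linked using (Linked)
import Data.List.Relation.Unary.Linked.Properties as Linked
open import Data.Nat.Base as ℕ using (ℕ; zero; suc; _!; _∸_; NonZero)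
import Data.Nat.Properties as ℕ
open import Data.Product.Base using (_×_; _,_; ∃; proj₁; proj₂; ∃-syntax)
open import Data.Sum.Base using (inj₁; inj₂)
open import Data.Vec.Base as Vec using (Vec)
import Data.Vec.Relation.Unary.AllPairs as AllPairs
open import Data.Vec.Relation.Unary.Unique.Propositional using (Unique)
open import Level using () renaming (_⊔_ to _⊔ˡ_; suc to lsuc)
open import Relation.Binary.Core using (Rel)
open import Relation.Binary.Bundles using (TotalOrder)
open import Relation.Binary.Structures using (IsDecTotalOrder)
open import Relation.Binary.PropositionalEquality.Core using (_≡_; _≢_)
open import Relation.Nullary.Decidable
  using (yes; no; does; ¬?; _×-dec_; decidable-stable)
open import Relation.Nullary.Negation.Core using (¬_; contradiction)
open import Relation.Unary using (Pred; Decidable)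

private
  variable
    n k : ℕ

-- The elements are listed in increasing order, so that equality of sets
-- is equality of lists.

record PositiveSet : Set where
  field
    elements   : List ℕ
    increasing : Linked ℕ._<_ elements
    positive   : All (0 ℕ.<_) elements

open PositiveSet public

#_ : PositiveSet → ℕ
# I = length (elements I)

-- The value 0 on the empty set is a convention.

max : PositiveSet → ℕ
max I = Extrema.max 0 (elements I)

≢max? : ∀ I → Decidable (_≢ max I)
≢max? I j = ¬? (j ℕ.≟ max I)

_∖max : PositiveSet → PositiveSet
I ∖max = record
  { elements   = filter (≢max? I) (elements I)
  ; increasing = Linked.filter⁺ (≢max? I) ℕ.<-trans (increasing I)
  ; positive   = All.filter⁺ (≢max? I) (positive I)
  }

max∖max<max : ∀ I → 2 ℕ.≤ # I → max (I ∖max) ℕ.< max I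
max∖max<max I 2≤#I =
  Extrema.max<v⁺ (0<max (elements I) (positive I) 2≤#I) below
  where
  0<max : ∀ xs → All (0 ℕ.<_) xs → 2 ℕ.≤ length xs → 0 ℕ.< Extrema.max 0 xs
  0<max (x ∷ xs) (0<x ∷ _) _ =
    ℕ.<-≤-trans 0<x (All.head (Extrema.xs≤max 0 (x ∷ xs)))

  below : All (ℕ._< max I) (elements (I ∖max))
  below = All.zipWith (λ (p , q) → ℕ.≤∧≢⇒< p q)
    ( All.filter⁺ (≢max? I) (Extrema.xs≤max 0 (elements I))
    , All.all-filter (≢max? I) (elements I))

-- Permutations are in one-line notation: π₁ ⋯ πₙ is a vector of n
-- pairwise distinct elements of Fin n.

words : ∀ n k → List (Vec (Fin n) k)
words n zero    = Vec.[] ∷ []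
words n (suc k) = cartesianProductWith Vec._∷_ (allFin n) (words n k)

unique? : Decidable (Unique {A = Fin n} {n = k})
unique? = AllPairs.allPairs? (λ i j → ¬? (i Fin.≟ j))

-- The argument j is the index given to the first letter of the word.

descentsFrom : ℕ → Vec (Fin n) k → List ℕ
descentsFrom j Vec.[]            = []
descentsFrom j (x Vec.∷ Vec.[])  = []
descentsFrom j (x Vec.∷ y Vec.∷ w) =
  let ds = descentsFrom (suc j) (y Vec.∷ w) in
  if does (y Fin.<? x) then j ∷ ds else ds

descents : Vec (Fin n) k → List ℕ
descents = descentsFrom 1

IsPermutationWithDescents : PositiveSet → Pred (Vec (Fin n) n) _
IsPermutationWithDescents I π = Unique π × descents π ≡ elements I

isPermutationWithDescents? : ∀ I → Decidable (IsPermutationWithDescents {n} I)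
isPermutationWithDescents? I π =
  unique? π ×-dec List.≡-dec ℕ._≟_ (descents π) (elements I)

#permutations : PositiveSet → ℕ → ℕ
#permutations I n = length (filter (isPermutationWithDescents? I) (words n n))

-- The axioms of a complete ordered field, which determine ℝ up to
-- isomorphism.  The reals are the classical ones: the order is decidable,
-- so the record is inhabited under excluded middle but not constructively.

record RealNumbers c ℓ : Set (lsuc (c ⊔ˡ ℓ)) where
  infix 4 _≤_
  field
    commutativeRing : CommutativeRing c ℓ

  open CommutativeRing commutativeRing public

  field
    _≤_             : Rel Carrier ℓ
    isDecTotalOrder : IsDecTotalOrder _≈_ _≤_
    0≉1             : ¬ 0# ≈ 1#
    invertible      : ∀ x → ¬ x ≈ 0# → ∃[ y ] x * y ≈ 1#
    +-monoˡ-≤       : ∀ z {x y} → x ≤ y → x + z ≤ y + z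
    *-nonNeg        : ∀ {x y} → 0# ≤ x → 0# ≤ y → 0# ≤ x * y

  UpperBound : Pred Carrier ℓ → Pred Carrier (c ⊔ˡ ℓ)
  UpperBound P u = ∀ x → P x → x ≤ u

  IsSupremum : Pred Carrier ℓ → Pred Carrier (c ⊔ˡ ℓ)
  IsSupremum P s = UpperBound P s × (∀ u → UpperBound P u → s ≤ u)

  field
    supremum        : ∀ P → ∃ P → ∃ (UpperBound P) → ∃ (IsSupremum P)

  open IsDecTotalOrder isDecTotalOrder public
    using (_≤?_; total; antisym; isTotalOrder)
    renaming (refl to ≤-refl; trans to ≤-trans; reflexive to ≤-reflexive)

  totalOrder : TotalOrder c ℓ ℓ
  totalOrder = record { isTotalOrder = isTotalOrder }

  open NaturalMin totalOrder public using (_⊓_)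
  open NaturalMax totalOrder public using (_⊔_)
  open RawSemiringDefinitions (Semiring.rawSemiring semiring) public
    using (_^_) renaming (_×_ to _·_)

  fromℕ : ℕ → Carrier
  fromℕ n = n · 1#

module Roots {c ℓ} (ℝ : RealNumbers c ℓ) where
  open RealNumbers ℝ
  open RingProperties ring
    using (-‿distribˡ-*; -‿distribʳ-*; -‿involutive; [y-z]x≈yx-zx; xyx⁻¹≈y)
  open SemiringSolver commutativeSemiring using (solve; _:=_; _:+_; _:*_; con)

  private
    x-y+y≈x : ∀ x y → (x - y) + y ≈ x
    x-y+y≈x x y = trans (+-assoc x (- y) y)
      (trans (+-congˡ (-‿inverseˡ y)) (+-identityʳ x))

    resp : ∀ {a b x y} → a ≈ b → x ≈ y → a ≤ x → b ≤ y
    resp a≈b x≈y a≤x =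
      ≤-trans (≤-reflexive (sym a≈b)) (≤-trans a≤x (≤-reflexive x≈y))

    +-monoʳ-≤ : ∀ z {x y} → x ≤ y → z + x ≤ z + y
    +-monoʳ-≤ z x≤y = resp (+-comm _ z) (+-comm _ z) (+-monoˡ-≤ z x≤y)

    ¬≤⇒≥ : ∀ {x y} → ¬ x ≤ y → y ≤ x
    ¬≤⇒≥ {x} {y} x≰y with total x y
    ... | inj₁ x≤y = contradiction x≤y x≰y
    ... | inj₂ y≤x = y≤x

    diff : ∀ {x y} → x ≤ y → 0# ≤ y - x
    diff {x} x≤y = resp (-‿inverseʳ x) refl (+-monoˡ-≤ (- x) x≤y)

    undiff : ∀ {x y} → 0# ≤ y - x → x ≤ y
    undiff {x} {y} p = resp (+-identityˡ x) (x-y+y≈x y x) (+-monoˡ-≤ x p)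

    *-monoˡ-≤ : ∀ {z x y} → 0# ≤ z → x ≤ y → x * z ≤ y * z
    *-monoˡ-≤ {z} {x} {y} 0≤z x≤y =
      undiff (resp refl ([y-z]x≈yx-zx z y x) (*-nonNeg (diff x≤y) 0≤z))

    *-mono-≤ : ∀ {w x y z} → 0# ≤ w → 0# ≤ y → w ≤ x → y ≤ z → w * y ≤ x * z
    *-mono-≤ 0≤w 0≤y w≤x y≤z = ≤-trans (*-monoˡ-≤ 0≤y w≤x)
      (resp (*-comm _ _) (*-comm _ _) (*-monoˡ-≤ (≤-trans 0≤w w≤x) y≤z))

    +-nonNeg : ∀ {x y} → 0# ≤ x → 0# ≤ y → 0# ≤ x + y
    +-nonNeg {x} {y} 0≤x 0≤y =
      ≤-trans 0≤y (resp (+-identityˡ y) refl (+-monoˡ-≤ y 0≤x))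

    x≤x+y : ∀ {x y} → 0# ≤ y → x ≤ x + y
    x≤x+y {x} 0≤y = resp (+-identityʳ x) refl (+-monoʳ-≤ x 0≤y)

    +-cancelˡ-≤0 : ∀ {x y} → x + y ≤ x → y ≤ 0#
    +-cancelˡ-≤0 {x} {y} p =
      resp (xyx⁻¹≈y x y) (-‿inverseʳ x) (+-monoˡ-≤ (- x) p)

  square-nonNeg : ∀ x → 0# ≤ x * x
  square-nonNeg x with total 0# x
  ... | inj₁ 0≤x = *-nonNeg 0≤x 0≤x
  ... | inj₂ x≤0 = resp refl (lemma x) (*-nonNeg 0≤-x 0≤-x)
    where
    0≤-x : 0# ≤ - x
    0≤-x = resp refl (+-identityˡ _) (diff x≤0)
    lemma : ∀ x → (- x) * (- x) ≈ x * x
    lemma x = trans (sym (-‿distribˡ-* x (- x)))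
      (trans (-‿cong (sym (-‿distribʳ-* x x))) (-‿involutive (x * x)))

  sumOfSquares-nonNeg : ∀ x y → 0# ≤ x * x + y * y
  sumOfSquares-nonNeg x y = +-nonNeg (square-nonNeg x) (square-nonNeg y)

  private
    0≤1 : 0# ≤ 1#
    0≤1 = resp refl (*-identityˡ 1#) (square-nonNeg 1#)

    1≰0 : ¬ 1# ≤ 0#
    1≰0 1≤0 = 0≉1 (antisym 0≤1 1≤0)

    ^-nonNeg : ∀ r {x} → 0# ≤ x → 0# ≤ x ^ r
    ^-nonNeg zero    0≤x = 0≤1
    ^-nonNeg (suc r) 0≤x = *-nonNeg 0≤x (^-nonNeg r 0≤x)

    ^-mono : ∀ r {x y} → 0# ≤ x → x ≤ y → x ^ r ≤ y ^ r
    ^-mono zero    0≤x x≤y = ≤-refl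
    ^-mono (suc r) 0≤x x≤y = *-mono-≤ 0≤x (^-nonNeg r 0≤x) x≤y (^-mono r 0≤x x≤y)

    ^-cong : ∀ r {x y} → x ≈ y → x ^ r ≈ y ^ r
    ^-cong zero    x≈y = refl
    ^-cong (suc r) x≈y = *-cong x≈y (^-cong r x≈y)

    1≤^ : ∀ r {x} → 1# ≤ x → 1# ≤ x ^ r
    1≤^ zero    1≤x = ≤-refl
    1≤^ (suc r) 1≤x =
      resp (*-identityˡ 1#) refl (*-mono-≤ 0≤1 0≤1 1≤x (1≤^ r 1≤x))

    0^r≤ : ∀ r .{{_ : NonZero r}} {b} → 0# ≤ b → 0# ^ r ≤ b
    0^r≤ (suc r) 0≤b = resp (sym (zeroˡ _)) refl 0≤b

    -- Lipschitz bound for the r-th power on [0, S].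
    lipschitz : ∀ r S → 0# ≤ S → ∃[ C ] (0# ≤ C × (∀ t ε → 0# ≤ t → t ≤ S →
                0# ≤ ε → ε ≤ 1# → (t + ε) ^ r ≤ t ^ r + ε * C))
    lipschitz zero S 0≤S =
      0# , ≤-refl , λ t ε _ _ _ _ → ≤-reflexive
        (sym (trans (+-congˡ (zeroʳ ε)) (+-identityʳ 1#)))
    lipschitz (suc r) S 0≤S with lipschitz r S 0≤S
    ... | C , 0≤C , bound =
      S * C + S ^ r + C ,
      +-nonNeg (+-nonNeg (*-nonNeg 0≤S 0≤C) (^-nonNeg r 0≤S)) 0≤C ,
      λ t ε 0≤t t≤S 0≤ε ε≤1 →
        ≤-trans
          (*-mono-≤ (+-nonNeg 0≤t 0≤ε) (^-nonNeg r (+-nonNeg 0≤t 0≤ε))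
                    ≤-refl (bound t ε 0≤t t≤S 0≤ε ε≤1))
          (resp (sym (expand t ε C (t ^ r))) refl
            (+-monoʳ-≤ (t * t ^ r)
              (resp (*-comm _ _) (*-comm _ _)
                (*-monoˡ-≤ 0≤ε
                  (+-mono (+-mono (*-monoˡ-≤ 0≤C t≤S) (^-mono r 0≤t t≤S))
                    (resp refl (*-identityˡ C) (*-monoˡ-≤ 0≤C ε≤1)))))))
      where
      +-mono : ∀ {w x y z} → w ≤ x → y ≤ z → w + y ≤ x + z
      +-mono {x = x} {y = y} p q = ≤-trans (+-monoˡ-≤ y p) (+-monoʳ-≤ x q)
      expand : ∀ t ε C p →
        (t + ε) * (p + ε * C) ≈ t * p + ε * (t * C + p + ε * C)
      expand = solve 4 (λ t ε C p →
        (t :+ ε) :* (p :+ ε :* C) := t :* p :+ ε :* (t :* C :+ p :+ ε :* C)) refl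

    ⊓-≤ˡ : ∀ x y → x ⊓ y ≤ x
    ⊓-≤ˡ x y with total x y
    ... | inj₁ _   = ≤-refl
    ... | inj₂ y≤x = y≤x

    ⊓-≤ʳ : ∀ x y → x ⊓ y ≤ y
    ⊓-≤ʳ x y with total x y
    ... | inj₁ x≤y = x≤y
    ... | inj₂ _   = ≤-refl

    ⊓-pos : ∀ x y → ¬ x ≤ 0# → ¬ y ≤ 0# → ¬ x ⊓ y ≤ 0#
    ⊓-pos x y x≰0 y≰0 with total x y
    ... | inj₁ _ = x≰0
    ... | inj₂ _ = y≰0

    -- ε in (0, 1] with ε (C + 1) ≤ δ.
    small : ∀ C δ → 0# ≤ C → ¬ δ ≤ 0# →
            ∃[ ε ] (¬ ε ≤ 0# × ε ≤ 1# × ε * (C + 1#) ≤ δ)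
    small C δ 0≤C δ≰0 with invertible (C + 1#) C+1≉0
      where
      C+1≉0 : ¬ C + 1# ≈ 0#
      C+1≉0 eq = 1≰0 (≤-trans (resp (+-identityˡ 1#) refl (+-monoˡ-≤ 1# 0≤C))
                              (≤-reflexive eq))
    ... | i , inv = 1# ⊓ q , ⊓-pos 1# q 1≰0 q≰0 , ⊓-≤ˡ 1# q ,
      resp refl q*[C+1] (*-monoˡ-≤ 0≤C+1 (⊓-≤ʳ 1# q))
      where
      q : Carrier
      q = δ * i
      0≤C+1 : 0# ≤ C + 1#
      0≤C+1 = +-nonNeg 0≤C 0≤1
      q*[C+1] : q * (C + 1#) ≈ δ
      q*[C+1] = trans (*-assoc δ i _)
        (trans (*-congˡ (trans (*-comm i _) inv)) (*-identityʳ δ))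
      q≰0 : ¬ q ≤ 0#
      q≰0 q≤0 = δ≰0 (resp q*[C+1] (zeroˡ _) (*-monoˡ-≤ 0≤C+1 q≤0))

    Below : ℕ → Carrier → Pred Carrier ℓ
    Below r b x = 0# ≤ x × x ^ r ≤ b

    bounded : ∀ r .{{_ : NonZero r}} b → 0# ≤ b → UpperBound (Below r b) (1# + b)
    bounded (suc r) b 0≤b x (0≤x , x^r≤b) with total x 1#
    ... | inj₁ x≤1 = ≤-trans x≤1 (x≤x+y 0≤b)
    ... | inj₂ 1≤x = ≤-trans
      (resp (*-identityʳ x) refl (*-mono-≤ 0≤x 0≤1 ≤-refl (1≤^ r 1≤x)))
      (≤-trans x^r≤b (resp refl (+-comm b 1#) (x≤x+y 0≤1)))

    sup : ∀ r .{{_ : NonZero r}} b → 0# ≤ b → ∃ (IsSupremum (Below r b))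
    sup r b 0≤b = supremum (Below r b)
      (0# , ≤-refl , 0^r≤ r 0≤b) (1# + b , bounded r b 0≤b)

  -- b^(1/r), as the supremum of the x ≥ 0 with x^r ≤ b; root-nonNeg and
  -- root-^ characterise it.

  root : ∀ r .{{_ : NonZero r}} b → 0# ≤ b → Carrier
  root r b 0≤b = proj₁ (sup r b 0≤b)

  root-nonNeg : ∀ r .{{_ : NonZero r}} b (0≤b : 0# ≤ b) → 0# ≤ root r b 0≤b
  root-nonNeg r b 0≤b = proj₁ (proj₂ (sup r b 0≤b)) 0# (≤-refl , 0^r≤ r 0≤b)

  root-^ : ∀ r .{{_ : NonZero r}} b (0≤b : 0# ≤ b) → root r b 0≤b ^ r ≈ b
  root-^ r b 0≤b = antisym
    (decidable-stable (s ^ r ≤? b) upper)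
    (decidable-stable (b ≤? s ^ r) lower)
    where
    s : Carrier
    s = root r b 0≤b
    0≤s : 0# ≤ s
    0≤s = root-nonNeg r b 0≤b
    ub : UpperBound (Below r b) s
    ub = proj₁ (proj₂ (sup r b 0≤b))
    lub : ∀ u → UpperBound (Below r b) u → s ≤ u
    lub = proj₂ (proj₂ (sup r b 0≤b))

    cancel : ∀ x y → x + (y - x) ≈ y
    cancel x y = trans (+-comm x (y - x)) (x-y+y≈x y x)

    pos : ∀ {x y} → ¬ x ≤ y → ¬ x - y ≤ 0#
    pos {x} {y} x≰y p = x≰y (resp (x-y+y≈x x y) (+-identityˡ y) (+-monoˡ-≤ y p))

    lower : ¬ ¬ b ≤ s ^ r
    lower b≰s^r with lipschitz r s 0≤s
    ... | C , 0≤C , bound with small C (b - s ^ r) 0≤C (pos b≰s^r)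
    ... | ε , ε≰0 , ε≤1 , εC≤δ = ε≰0 (+-cancelˡ-≤0 (ub (s + ε) (+-nonNeg 0≤s 0≤ε ,
        ≤-trans (bound s ε 0≤s ≤-refl 0≤ε ε≤1)
          (resp refl (cancel (s ^ r) b) (+-monoʳ-≤ (s ^ r)
            (≤-trans (resp (*-comm _ _) (*-comm _ _) (*-monoˡ-≤ 0≤ε (x≤x+y 0≤1)))
              εC≤δ))))))
      where
      0≤ε : 0# ≤ ε
      0≤ε = ¬≤⇒≥ ε≰0

    upper : ¬ ¬ s ^ r ≤ b
    upper s^r≰b with lipschitz r s 0≤s
    ... | C , 0≤C , bound with small C (s ^ r - b) 0≤C (pos s^r≰b)
    ... | ε₀ , ε₀≰0 , ε₀≤1 , ε₀C≤δ = ε≰0 (+-cancelˡ-≤0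
        (resp refl (x-y+y≈x s ε) (+-monoˡ-≤ ε (lub t t-ub))))
      where
      s≰0 : ¬ s ≤ 0#
      s≰0 s≤0 = s^r≰b (resp (^-cong r (antisym 0≤s s≤0)) refl (0^r≤ r 0≤b))
      ε : Carrier
      ε = ε₀ ⊓ s
      ε≰0 : ¬ ε ≤ 0#
      ε≰0 = ⊓-pos ε₀ s ε₀≰0 s≰0
      0≤ε : 0# ≤ ε
      0≤ε = ¬≤⇒≥ ε≰0
      t : Carrier
      t = s - ε
      0≤t : 0# ≤ t
      0≤t = diff (⊓-≤ʳ ε₀ s)
      t≤s : t ≤ s
      t≤s = resp refl (x-y+y≈x s ε) (x≤x+y 0≤ε)
      s^r≤ : s ^ r ≤ t ^ r + ε * C
      s^r≤ = resp (^-cong r (x-y+y≈x s ε)) refl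
        (bound t ε 0≤t t≤s 0≤ε (≤-trans (⊓-≤ˡ ε₀ s) ε₀≤1))
      εC≤δ : ε * (C + 1#) ≤ s ^ r - b
      εC≤δ = ≤-trans (*-monoˡ-≤ (+-nonNeg 0≤C 0≤1) (⊓-≤ˡ ε₀ s)) ε₀C≤δ
      t-ub : UpperBound (Below r b) t
      t-ub x (0≤x , x^r≤b) with x ≤? t
      ... | yes x≤t = x≤t
      ... | no  x≰t = contradiction (+-cancelˡ-≤0 {x = b + ε * C} (≤-trans
              (resp (e₁ b ε C) (cancel b (s ^ r)) (+-monoʳ-≤ b εC≤δ))
              (≤-trans s^r≤ (+-monoˡ-≤ (ε * C)
                (≤-trans (^-mono r 0≤t (¬≤⇒≥ x≰t)) x^r≤b))))) ε≰0
        where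
        e₁ : ∀ b ε C → b + ε * (C + 1#) ≈ (b + ε * C) + ε
        e₁ = solve 3 (λ b ε C →
          b :+ ε :* (C :+ con 1) := (b :+ ε :* C) :+ ε) refl

  fromℕ-nonNeg : ∀ n → 0# ≤ fromℕ n
  fromℕ-nonNeg zero    = ≤-refl
  fromℕ-nonNeg (suc n) = +-nonNeg 0≤1 (fromℕ-nonNeg n)

module Complex {c ℓ} (ℝ : RealNumbers c ℓ) where
  open RealNumbers ℝ
  open Roots ℝ

  record ℂ : Set c where
    constructor _+i_
    field
      Re Im : Carrier

  open ℂ public

  infix 4 _≈ᶜ_
  _≈ᶜ_ : Rel ℂ ℓ
  z ≈ᶜ w = Re z ≈ Re w × Im z ≈ Im w

  infixl 6 _+ᶜ_ _-ᶜ_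
  infixl 7 _*ᶜ_
  _+ᶜ_ _-ᶜ_ _*ᶜ_ : ℂ → ℂ → ℂ
  z +ᶜ w = (Re z + Re w) +i (Im z + Im w)
  z -ᶜ w = (Re z - Re w) +i (Im z - Im w)
  z *ᶜ w = (Re z * Re w - Im z * Im w) +i (Re z * Im w + Im z * Re w)

  0ᶜ : ℂ
  0ᶜ = 0# +i 0#

  fromℕᶜ : ℕ → ℂ
  fromℕᶜ n = fromℕ n +i 0#

  ∣_∣ : Carrier → Carrier
  ∣ x ∣ = x ⊔ (- x)

  ∣_∣ᶜ : ℂ → Carrier
  ∣ z ∣ᶜ = root 2 (Re z * Re z + Im z * Im z) (sumOfSquares-nonNeg (Re z) (Im z))

  -- Coefficients, constant term first.

  Polynomial : Set c
  Polynomial = List ℂ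

  eval : Polynomial → ℂ → ℂ
  eval []      z = 0ᶜ
  eval (a ∷ p) z = a +ᶜ z *ᶜ eval p z

  -- A polynomial is determined by its values at the integers n > max I,
  -- so this holds of d(I;z) only, up to trailing zero coefficients.

  IsDescentPolynomial : PositiveSet → Polynomial → Set ℓ
  IsDescentPolynomial I d =
    ∀ n → max I ℕ.< n → eval d (fromℕᶜ n) ≈ᶜ fromℕᶜ (#permutations I n)

  radius : ∀ I → 2 ℕ.≤ # I → Carrier
  radius I 2≤#I = (fromℕ (m !) + 1#) ⊓ root (m ∸ m⁻) b (fromℕ-nonNeg (m ! ℕ.* # I))
    where
    m m⁻ : ℕ
    m  = max I
    m⁻ = max (I ∖max)
    b : Carrier
    b = fromℕ (m ! ℕ.* # I)
    instance
      m∸m⁻≢0 : NonZero (m ∸ m⁻)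
      m∸m⁻≢0 = ℕ.>-nonZero (ℕ.m<n⇒0<n∸m (max∖max<max I 2≤#I))

  Disc : ℕ → Carrier → Pred ℂ ℓ
  Disc k ρ z = ∣ z -ᶜ fromℕᶜ k ∣ᶜ ≤ ρ

{-# OPTIONS --safe #-}

-- Counting the permutations of n > m letters whose first m letters have descent
-- set I⁻ and whose other letters increase gives
--   d (I; n) + d (I⁻; n) = binomial n m * d (I⁻; m),   1 ≤ d (I⁻; m) ≤ m !.
-- Iterating, d (I; z) is an alternating sum of the falling factorials
-- z (z - 1) ⋯ (z - i + 1), i ∈ I ∪ {0}, with coefficients in [0, 1], the leading
-- one being at least 1 / m !.  Let pᵢ be the product of the |z - k| over k < i.
-- At a root z, the leading term gives pₘ ≤ m ! (Σ pᵢ), summed over i ∈ I⁻ ∪ {0}.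
-- If every |z - k| exceeds m ! + 1, then m ! pᵢ ≤ pᵢ₊₁ - pᵢ, and the sum telescopes
-- to less than pₘ.  If every |z - k| exceeds ρ with ρ ^ (m - m⁻) = m ! #I, then
-- ρ ≥ 1, so the sum is at most #I p_{m⁻} < pₘ / m !.
module Submission where

open import Algebra.Bundles using (CommutativeRing; RawRing)
open import Data.List.Base using (List; []; _∷_; length; reverse)
import Data.List.Properties as List
open import Data.Nat using (ℕ; _<_) renaming (_≤_ to _≤ⁿ_)
open import Data.Nat.Base as ℕ using (zero; suc; _!; NonZero; s≤s; z≤n; _∸_)
open import Data.Nat.Combinatorics.Base using (_P′_)
import Data.Nat.Properties as ℕ
open import Data.Product using (_×_; _,_; ∃-syntax; proj₁; proj₂)
open import Data.Sum using (_⊎_; inj₁; inj₂)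
open import Relation.Binary.PropositionalEquality.Core as ≡ using (_≡_)
open import Relation.Nullary using (¬_; yes; no; contradiction)
open import Relation.Nullary.Decidable using (decidable-stable)
open import Defs

-- The polynomial is known only through its values at the integers beyond `max I`, so the counting
-- identity is proved there and carried to all complex z by uniqueness of polynomial functions. A
-- direct bijection for the factor binomial n m would have to standardise both blocks of a
-- permutation. Instead the count is done by induction on n, a permutation of n + 1 letters being
-- one of n letters with a new minimum inserted: the minimum lies in the first block or opens the
-- second, which is Pascal's rule. Falling factorials replace binomials, so everything stays in ℕ
-- until `coefficient` divides by m !. The sum of the pᵢ has exactly #I terms because the index 0
-- takes the place of m. Each of the two estimates refutes a root lying outside all discs of its own
-- radius, and ρ is one of the two radii. Neither estimate names a disc containing the root; a
-- finite search over k does.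

module Combinatorics where
  open import Data.Bool.Base using (true; false; if_then_else_)
  open import Data.Fin.Base using (Fin; toℕ; fromℕ<)
  open import Data.Fin.Properties using (toℕ-injective; toℕ<n; toℕ-fromℕ<)
  open import Data.List.Base
    using (_++_; _∷ʳ_; [_]; map; take; drop; concatMap; filter)
  import Data.List.Extrema.Nat as Extrema
  open import Data.List.Membership.Propositional using (_∈_)
  open import Data.List.Membership.Propositional.Properties
  open import Data.List.Membership.Propositional.Properties.WithK using (unique∧set⇒bag)
  open import Data.List.Properties
    using (map-++; map-∘; map-cong; length-map; take-map; drop-map; ++-identityʳ)
  open import Data.List.Relation.Binary.BagAndSetEquality using (∼bag⇒↭)
  open import Data.List.Relation.Binary.Disjoint.Propositional using (Disjoint)
  open import Data.List.Relation.Binary.Permutation.Propositional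
    using (_↭_; ↭-refl; ↭-sym; ↭-trans; ↭-prep; ↭-swap; ↭⇒↭ₛ)
  open import Data.List.Relation.Binary.Permutation.Propositional.Properties
    using (shift; All-resp-↭; ↭-length; map⁺)
  open import Data.List.Relation.Unary.All as All using (All; []; _∷_)
  import Data.List.Relation.Unary.All.Properties as All
  open import Data.List.Relation.Unary.AllPairs as AllPairs using (AllPairs; []; _∷_)
  import Data.List.Relation.Unary.AllPairs.Properties as AllPairs
  open import Data.List.Relation.Unary.Any using (here; there)
  import Data.List.Relation.Unary.Linked.Properties as Linked
  open import Data.List.Relation.Unary.Unique.Propositional using (Unique)
  import Data.List.Relation.Unary.Unique.Propositional.Properties as Unique
  open import Data.Nat
  open import Data.Nat.Combinatorics.Specification using (P′-rec; nP′n≡n!)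
  open import Data.Nat.ListAction using (sum)
  open import Data.Nat.ListAction.Properties using (sum-++; sum-↭)
  open import Data.Nat.Properties
  open import Data.Nat.Tactic.RingSolver using (solve-∀)
  open import Data.Vec.Base as Vec using (Vec)
  import Data.Vec.Relation.Unary.All as VecAll
  import Data.Vec.Relation.Unary.AllPairs as VecPairs
  open import Data.Vec.Relation.Unary.Unique.Propositional using () renaming (Unique to VecUnique)
  open import Function using (_∘_; mk⇔)
  open import Relation.Binary.Definitions using (tri<; tri≈; tri>)
  open import Relation.Binary.PropositionalEquality hiding ([_])
  open import Relation.Nullary using (Dec; does)
  open import Relation.Nullary.Decidable using (does-⇔; dec-true; dec-false)
  open import Data.List.Membership.DecPropositional _≟_ using (_∈?_)
  open import Data.List.Relation.Binary.Permutation.Setoid.Properties (setoid ℕ)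
    using (AllPairs-resp-↭)

  -- Sums over lists and Kronecker deltas

  ∑ : ∀ {A : Set} → List A → (A → ℕ) → ℕ
  ∑ xs f = sum (map f xs)

  module _ {A : Set} where

    ∑-cong : ∀ {f g : A → ℕ} → (∀ x → f x ≡ g x) → ∀ xs → ∑ xs f ≡ ∑ xs g
    ∑-cong f≗g xs = cong sum (map-cong f≗g xs)

    ∑-cong-All : ∀ {P : A → Set} {f g : A → ℕ} {xs} →
                 All P xs → (∀ x → P x → f x ≡ g x) → ∑ xs f ≡ ∑ xs g
    ∑-cong-All []         f≗g = refl
    ∑-cong-All (px ∷ pxs) f≗g = cong₂ _+_ (f≗g _ px) (∑-cong-All pxs f≗g)

    ∑-++ : ∀ (f : A → ℕ) xs ys → ∑ (xs ++ ys) f ≡ ∑ xs f + ∑ ys f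
    ∑-++ f xs ys = trans (cong sum (map-++ f xs ys)) (sum-++ (map f xs) (map f ys))

    ∑-+ : ∀ (f g : A → ℕ) xs → ∑ xs (λ x → f x + g x) ≡ ∑ xs f + ∑ xs g
    ∑-+ f g []       = refl
    ∑-+ f g (x ∷ xs) = trans (cong (f x + g x +_) (∑-+ f g xs))
      (+-interchange (f x) (g x) (∑ xs f) (∑ xs g))
      where
      +-interchange : ∀ a b c d → a + b + (c + d) ≡ a + c + (b + d)
      +-interchange = solve-∀

    ∑-*ˡ : ∀ c (f : A → ℕ) xs → ∑ xs (λ x → c * f x) ≡ c * ∑ xs f
    ∑-*ˡ c f []       = sym (*-zeroʳ c)
    ∑-*ˡ c f (x ∷ xs) =
      trans (cong (c * f x +_) (∑-*ˡ c f xs)) (sym (*-distribˡ-+ c (f x) (∑ xs f)))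

    ∑-*ʳ : ∀ c (f : A → ℕ) xs → ∑ xs (λ x → f x * c) ≡ ∑ xs f * c
    ∑-*ʳ c f []       = refl
    ∑-*ʳ c f (x ∷ xs) =
      trans (cong (f x * c +_) (∑-*ʳ c f xs)) (sym (*-distribʳ-+ c (f x) (∑ xs f)))

    ∑-mono : ∀ {f g : A → ℕ} → (∀ x → f x ≤ g x) → ∀ xs → ∑ xs f ≤ ∑ xs g
    ∑-mono f≤g []       = z≤n
    ∑-mono f≤g (x ∷ xs) = +-mono-≤ (f≤g x) (∑-mono f≤g xs)

    ∈⇒≤∑ : ∀ (f : A → ℕ) {x xs} → x ∈ xs → f x ≤ ∑ xs f
    ∈⇒≤∑ f (here refl)  = m≤m+n _ _
    ∈⇒≤∑ f (there x∈xs) = ≤-trans (∈⇒≤∑ f x∈xs) (m≤n+m _ _)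

  ∑-map : ∀ {A B : Set} (f : B → ℕ) (g : A → B) xs → ∑ (map g xs) f ≡ ∑ xs (f ∘ g)
  ∑-map f g xs = cong sum (sym (map-∘ xs))

  ∑-concatMap : ∀ {A B : Set} (f : B → ℕ) (g : A → List B) xs →
                ∑ (concatMap g xs) f ≡ ∑ xs (λ x → ∑ (g x) f)
  ∑-concatMap f g []       = refl
  ∑-concatMap f g (x ∷ xs) =
    trans (∑-++ f (g x) (concatMap g xs)) (cong (∑ (g x) f +_) (∑-concatMap f g xs))

  _≟ˡ_ : (xs ys : List ℕ) → Dec (xs ≡ ys)
  _≟ˡ_ = List.≡-dec _≟_

  -- Valued in ℕ, so that counting is summing and a conjunction of conditions on two blocks is a
  -- product.
  δ : List ℕ → List ℕ → ℕ
  δ xs ys = if does (xs ≟ˡ ys) then 1 else 0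

  δ-⇔ : ∀ {xs ys xs′ ys′} → (xs ≡ ys → xs′ ≡ ys′) → (xs′ ≡ ys′ → xs ≡ ys) →
        δ xs ys ≡ δ xs′ ys′
  δ-⇔ {xs} {ys} {xs′} {ys′} f g =
    cong (if_then 1 else 0) (does-⇔ (mk⇔ f g) (xs ≟ˡ ys) (xs′ ≟ˡ ys′))

  δ-yes : ∀ {xs ys} → xs ≡ ys → δ xs ys ≡ 1
  δ-yes {xs} {ys} eq = cong (if_then 1 else 0) (dec-true (xs ≟ˡ ys) eq)

  δ-no : ∀ {xs ys} → xs ≢ ys → δ xs ys ≡ 0
  δ-no {xs} {ys} neq = cong (if_then 1 else 0) (dec-false (xs ≟ˡ ys) neq)

  δ≤1 : ∀ xs ys → δ xs ys ≤ 1
  δ≤1 xs ys with does (xs ≟ˡ ys)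
  ... | true  = ≤-refl
  ... | false = z≤n

  -- Permutations by insertion of a new minimum, and their descents

  insertions : ∀ {A : Set} → A → List A → List (List A)
  insertions x []       = [ [ x ] ]
  insertions x (y ∷ ys) = (x ∷ y ∷ ys) ∷ map (y ∷_) (insertions x ys)

  -- Raising the old letters by `suc` preserves their comparisons, and the inserted 0 is below all
  -- of them, so the comparisons on both sides of it are known in advance.
  perms : ℕ → List (List ℕ)
  perms zero    = [ [] ]
  perms (suc n) = concatMap (λ w → insertions 0 (map suc w)) (perms n)

  insertions-map : ∀ {A B : Set} (f : A → B) x xs →
                   insertions (f x) (map f xs) ≡ map (map f) (insertions x xs)
  insertions-map f x []       = refl
  insertions-map f x (y ∷ ys) = cong ((f x ∷ f y ∷ map f ys) ∷_)
    (trans (cong (map (f y ∷_)) (insertions-map f x ys))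
      (trans (sym (map-∘ (insertions x ys))) (map-∘ (insertions x ys))))

  -- An insertion at one of the positions 0 to `a` lands in the first block and pushes the cut one
  -- letter to the left in `w`; a later one leaves the first block as it was.
  ∑-insertions-split : ∀ {A : Set} (h : List A → List A → ℕ) x a w → suc a ≤ length w →
    ∑ (insertions x w) (λ w′ → h (take (suc a) w′) (drop (suc a) w′)) ≡
    ∑ (insertions x (take a w)) (λ u → h u (drop a w)) +
    ∑ (insertions x (drop (suc a) w)) (λ v → h (take (suc a) w) v)
  ∑-insertions-split h x zero (y ∷ ys) _ = cong₂ _+_ (sym (+-identityʳ _))
    (∑-map _ (y ∷_) (insertions x ys))
  ∑-insertions-split h x (suc a) (y ∷ ys) (s≤s a<) = begin
    h₀ + ∑ (map (y ∷_) (insertions x ys)) (λ w′ → h (take (2 + a) w′) (drop (2 + a) w′))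
      ≡⟨ cong (h₀ +_) (trans (∑-map _ (y ∷_) (insertions x ys))
           (∑-insertions-split (h ∘ (y ∷_)) x a ys a<)) ⟩
    h₀ + (∑ (insertions x (take a ys)) (λ u → h (y ∷ u) (drop a ys)) + s)
      ≡⟨ +-assoc h₀ _ s ⟨
    h₀ + ∑ (insertions x (take a ys)) (λ u → h (y ∷ u) (drop a ys)) + s
      ≡⟨ cong (λ t → h₀ + t + s) (∑-map _ (y ∷_) (insertions x (take a ys))) ⟨
    h₀ + ∑ (map (y ∷_) (insertions x (take a ys))) (λ u → h u (drop a ys)) + s ∎
    where
    open ≡-Reasoning
    h₀ s : ℕ
    h₀ = h (x ∷ y ∷ take a ys) (drop a ys)
    s  = ∑ (insertions x (drop (suc a) ys)) (λ v → h (y ∷ take (suc a) ys) v)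

  desc : ℕ → List ℕ → List ℕ
  desc j []          = []
  desc j (x ∷ [])    = []
  desc j (x ∷ y ∷ w) = if does (y <? x) then j ∷ desc (suc j) (y ∷ w) else desc (suc j) (y ∷ w)

  Monotone : (ℕ → ℕ) → Set
  Monotone f = ∀ {x y} → x < y → f x < f y

  monotone-cancel : ∀ {f} → Monotone f → ∀ {x y} → f x < f y → x < y
  monotone-cancel f↑ {x} {y} fx<fy with <-cmp x y
  ... | tri< x<y _ _    = x<y
  ... | tri≈ _ refl _   = contradiction fx<fy (<-irrefl refl)
  ... | tri> _ _ y<x    = contradiction fx<fy (<-asym (f↑ y<x))

  desc-map : ∀ {f} → Monotone f → ∀ j w → desc j (map f w) ≡ desc j w
  desc-map f↑ j []          = refl
  desc-map f↑ j (x ∷ [])    = refl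
  desc-map {f} f↑ j (x ∷ y ∷ w)
    rewrite desc-map f↑ (suc j) (y ∷ w)
          | does-⇔ (mk⇔ (monotone-cancel f↑) f↑) (f y <? f x) (y <? x) = refl

  desc-suc : ∀ j w → desc (suc j) w ≡ map suc (desc j w)
  desc-suc j []          = refl
  desc-suc j (x ∷ [])    = refl
  desc-suc j (x ∷ y ∷ w) rewrite desc-suc (suc j) (y ∷ w) with does (y <? x)
  ... | true  = refl
  ... | false = refl

  δ-desc-suc : ∀ j w → δ (desc (suc j) w) [] ≡ δ (desc j w) []
  δ-desc-suc j w rewrite desc-suc j w with desc j w
  ... | []    = refl
  ... | _ ∷ _ = refl

  δ-desc : ∀ j w → δ (desc j w) [] ≡ δ (desc 0 w) []
  δ-desc zero    w = refl
  δ-desc (suc j) w = trans (δ-desc-suc j w) (δ-desc j w)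

  -- Every such insertion has a letter in front of the new minimum, and that pair is a descent.
  ∑-insertions-desc∷ : ∀ y j xs →
    ∑ (insertions 0 (map suc xs)) (λ v → δ (desc j (suc y ∷ v)) []) ≡ 0
  ∑-insertions-desc∷ y j []       = refl
  ∑-insertions-desc∷ y j (x ∷ xs)
    rewrite ∑-map (λ v → δ (desc j (suc y ∷ v)) []) (suc x ∷_) (insertions 0 (map suc xs))
    with does (suc x <? suc y)
  ... | true  = ∑-*ˡ 0 (λ _ → 0) (insertions 0 (map suc xs))
  ... | false = ∑-insertions-desc∷ x (suc j) xs

  -- Only the insertion at the very front avoids a descent, so increasing words extend in exactly
  -- one way.
  ∑-insertions-desc : ∀ j v →
    ∑ (insertions 0 (map suc v)) (λ v′ → δ (desc j v′) []) ≡ δ (desc j v) []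
  ∑-insertions-desc j []       = refl
  ∑-insertions-desc j (y ∷ ys) = begin
    δ (desc (suc j) (map suc (y ∷ ys))) [] + _
      ≡⟨ cong₂ _+_ (cong (λ d → δ d []) (desc-map s≤s (suc j) (y ∷ ys)))
           (trans (∑-map _ (suc y ∷_) (insertions 0 (map suc ys))) (∑-insertions-desc∷ y j ys)) ⟩
    δ (desc (suc j) (y ∷ ys)) [] + 0
      ≡⟨ +-identityʳ _ ⟩
    δ (desc (suc j) (y ∷ ys)) []
      ≡⟨ δ-desc-suc j (y ∷ ys) ⟩
    δ (desc j (y ∷ ys)) [] ∎
    where open ≡-Reasoning

  length-insertions : ∀ {A : Set} (x : A) xs → length (insertions x xs) ≡ suc (length xs)
  length-insertions x []       = refl
  length-insertions x (y ∷ ys) =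
    cong suc (trans (length-map (y ∷_) (insertions x ys)) (length-insertions x ys))

  insertions-↭ : ∀ {A : Set} (x : A) xs → All (_↭ x ∷ xs) (insertions x xs)
  insertions-↭ x []       = ↭-refl ∷ []
  insertions-↭ x (y ∷ ys) = ↭-refl ∷
    All.map⁺ (All.map (λ p → ↭-trans (↭-prep y p) (↭-swap y x ↭-refl)) (insertions-↭ x ys))

  ∈-insertions : ∀ {A : Set} (x : A) xs ys → xs ++ x ∷ ys ∈ insertions x (xs ++ ys)
  ∈-insertions x []       []       = here refl
  ∈-insertions x []       (_ ∷ _)  = here refl
  ∈-insertions x (z ∷ xs) ys       = there (∈-map⁺ (z ∷_) (∈-insertions x xs ys))

  -- The list `perms n` is complete and free of repetitions

  IsPerm : ℕ → List ℕ → Set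
  IsPerm n π = Unique π × All (_< n) π × length π ≡ n

  ∷-isPerm : ∀ {n w} → IsPerm n w → IsPerm (suc n) (0 ∷ map suc w)
  ∷-isPerm {w = w} (u , b , l) =
    All.map⁺ (All.universal (λ _ ()) w) ∷ Unique.map⁺ suc-injective u ,
    s≤s z≤n ∷ All.map⁺ (All.map s≤s b) ,
    cong suc (trans (length-map suc w) l)

  isPerm-resp-↭ : ∀ {n xs ys} → xs ↭ ys → IsPerm n xs → IsPerm n ys
  isPerm-resp-↭ p (u , b , l) =
    AllPairs-resp-↭ ≢-sym (resp₂ _≢_) (↭⇒↭ₛ p) u ,
    All-resp-↭ p b , trans (sym (↭-length p)) l

  perms-isPerm : ∀ n → All (IsPerm n) (perms n)
  perms-isPerm zero    = ([] , [] , refl) ∷ []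
  perms-isPerm (suc n) = All.concat⁺ (All.map⁺ (All.map
    (λ {w} p → All.map (λ q → isPerm-resp-↭ (↭-sym q) (∷-isPerm p))
      (insertions-↭ 0 (map suc w)))
    (perms-isPerm n)))

  perms-length : ∀ n → All (λ π → length π ≡ n) (perms n)
  perms-length n = All.map (proj₂ ∘ proj₂) (perms-isPerm n)

  #perms : ∀ n → ∑ (perms n) (λ _ → 1) ≡ n !
  #perms zero    = refl
  #perms (suc n) = begin
    ∑ (perms (suc n)) (λ _ → 1)
      ≡⟨ ∑-concatMap (λ _ → 1) (λ w → insertions 0 (map suc w)) (perms n) ⟩
    ∑ (perms n) (λ w → ∑ (insertions 0 (map suc w)) (λ _ → 1))
      ≡⟨ ∑-cong-All (perms-length n) (λ w l → trans (∑-1 (insertions 0 (map suc w)))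
           (trans (length-insertions 0 (map suc w)) (cong suc (trans (length-map suc w) l)))) ⟩
    ∑ (perms n) (λ _ → suc n)
      ≡⟨ ∑-cong (λ _ → sym (*-identityʳ (suc n))) (perms n) ⟩
    ∑ (perms n) (λ _ → suc n * 1)
      ≡⟨ ∑-*ˡ (suc n) (λ _ → 1) (perms n) ⟩
    suc n * ∑ (perms n) (λ _ → 1)
      ≡⟨ cong (suc n *_) (#perms n) ⟩
    suc n * n ! ∎
    where
    open ≡-Reasoning
    ∑-1 : ∀ {A : Set} (xs : List A) → ∑ xs (λ _ → 1) ≡ length xs
    ∑-1 []       = refl
    ∑-1 (x ∷ xs) = cong suc (∑-1 xs)

  private
    positive⇒map-suc : ∀ {xs} → All (0 ≢_) xs → ∃[ zs ] xs ≡ map suc zs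
    positive⇒map-suc []                           = [] , refl
    positive⇒map-suc {zero  ∷ xs} (0≢0 ∷ _)       = contradiction refl 0≢0
    positive⇒map-suc {suc x ∷ xs} (_ ∷ ps) with positive⇒map-suc ps
    ... | zs , refl = x ∷ zs , refl

    remove-0 : ∀ {n w} → Unique w → All (_< suc n) w →
      ∃[ z ] (Unique z × All (_< n) z × (w ≡ map suc z ⊎ w ∈ insertions 0 (map suc z)))
    remove-0 {n} {w} u b with 0 ∈? w
    ... | no 0∉w with positive⇒map-suc (All.¬Any⇒All¬ w 0∉w)
    ...   | z , refl =
      z , Unique.map⁻ u , All.map s≤s⁻¹ (All.map⁻ b) , inj₁ refl
    remove-0 {n} {w} u b | yes 0∈w with ∈-∃++ 0∈w
    ... | xs , ys , refl
      with AllPairs-resp-↭ ≢-sym (resp₂ _≢_) (↭⇒↭ₛ (shift 0 xs ys)) u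
         | All-resp-↭ (shift 0 xs ys) b
    ...   | 0∉ ∷ u′ | _ ∷ b′ with positive⇒map-suc 0∉
    ...     | z , eq rewrite eq = z , Unique.map⁻ u′ , All.map s≤s⁻¹ (All.map⁻ b′) ,
                inj₂ (subst (λ l → xs ++ 0 ∷ ys ∈ insertions 0 l) eq (∈-insertions 0 xs ys))

    length-∈-insertions : ∀ {z w} → w ∈ insertions 0 (map suc z) → length w ≡ suc (length z)
    length-∈-insertions {z} w∈ = trans (↭-length (All.lookup (insertions-↭ 0 (map suc z)) w∈))
      (cong suc (length-map suc z))

    -- The pigeonhole principle, by deleting 0 if present and lowering the rest. It excludes a
    -- permutation that lacks the letter 0 in `isPerm⇒∈perms`.
    length-bounded : ∀ n {w} → Unique w → All (_< n) w → length w ≤ n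
    length-bounded zero    {[]}    u b        = z≤n
    length-bounded zero    {_ ∷ _} u (() ∷ _)
    length-bounded (suc n) u b with remove-0 u b
    ... | z , u′ , b′ , inj₁ refl =
      ≤-trans (≤-reflexive (length-map suc z)) (m≤n⇒m≤1+n (length-bounded n u′ b′))
    ... | z , u′ , b′ , inj₂ w∈ =
      ≤-trans (≤-reflexive (length-∈-insertions w∈)) (s≤s (length-bounded n u′ b′))

  isPerm⇒∈perms : ∀ n {w} → IsPerm n w → w ∈ perms n
  isPerm⇒∈perms zero    {[]} _ = here refl
  isPerm⇒∈perms (suc n) (u , b , l) with remove-0 u b
  ... | z , u′ , b′ , inj₁ refl = contradiction (length-bounded n u′ b′)
          (<⇒≱ (≤-reflexive (trans (sym l) (length-map suc z))))
  ... | z , u′ , b′ , inj₂ w∈ = ∈-concat⁺′ w∈ (∈-map⁺ _ (isPerm⇒∈perms n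
          (u′ , b′ , suc-injective (trans (sym (length-∈-insertions w∈)) l))))

  private
    -- A left inverse of inserting a new minimum: it recovers the old word, so different old words
    -- have disjoint sets of insertions.
    strip : List ℕ → List ℕ
    strip []           = []
    strip (zero  ∷ xs) = strip xs
    strip (suc x ∷ xs) = x ∷ strip xs

    strip-map-suc : ∀ z → strip (map suc z) ≡ z
    strip-map-suc []      = refl
    strip-map-suc (x ∷ z) = cong (x ∷_) (strip-map-suc z)

    strip-insertions : ∀ z {w} → w ∈ insertions 0 (map suc z) → strip w ≡ z
    strip-insertions []      (here refl) = refl
    strip-insertions (x ∷ z) (here refl) = strip-map-suc (x ∷ z)
    strip-insertions (x ∷ z) (there w∈) with ∈-map⁻ (suc x ∷_) w∈
    ... | _ , w′∈ , refl = cong (x ∷_) (strip-insertions z w′∈)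

    insertions-unique : ∀ z → Unique (insertions 0 (map suc z))
    insertions-unique []      = [] ∷ []
    insertions-unique (x ∷ z) =
      All.map⁺ (All.universal (λ _ ()) (insertions 0 (map suc z))) ∷
      Unique.map⁺ List.∷-injectiveʳ (insertions-unique z)

  perms-unique : ∀ n → Unique (perms n)
  perms-unique zero    = [] ∷ []
  perms-unique (suc n) = Unique.concat⁺
    (All.map⁺ (All.universal insertions-unique (perms n)))
    (AllPairs.map⁺ (AllPairs.map disjoint (perms-unique n)))
    where
    disjoint : ∀ {z z′} → z ≢ z′ → Disjoint (insertions 0 (map suc z)) (insertions 0 (map suc z′))
    disjoint {z} {z′} z≢z′ (p , q) =
      z≢z′ (trans (sym (strip-insertions z p)) (strip-insertions z′ q))

  -- Permutations with an increasing final block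

  -- The weight q of the first m letters is kept arbitrary because inserting a
  -- new minimum among them replaces q by its sum over the insertions.
  Invariant : (List ℕ → ℕ) → Set
  Invariant q = ∀ {f} → Monotone f → ∀ u → q (map f u) ≡ q u

  insert-invariant : ∀ {q} → Invariant q → Invariant (λ u → ∑ (insertions 0 (map suc u)) q)
  insert-invariant {q} inv {f} f↑ u = begin
    ∑ (insertions 0 (map suc (map f u))) q
      ≡⟨ cong (λ l → ∑ (insertions 0 l) q) (trans (sym (map-∘ u)) (map-∘ u)) ⟩
    ∑ (insertions (f⁺ 0) (map f⁺ (map suc u))) q
      ≡⟨ cong (λ l → ∑ l q) (insertions-map f⁺ 0 (map suc u)) ⟩
    ∑ (map (map f⁺) (insertions 0 (map suc u))) q
      ≡⟨ ∑-map q (map f⁺) (insertions 0 (map suc u)) ⟩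
    ∑ (insertions 0 (map suc u)) (q ∘ map f⁺)
      ≡⟨ ∑-cong (inv f⁺↑) (insertions 0 (map suc u)) ⟩
    ∑ (insertions 0 (map suc u)) q ∎
    where
    open ≡-Reasoning
    -- The relabelling of the old letters, extended so that the new minimum stays fixed; insertion
    -- then commutes with it.
    f⁺ : ℕ → ℕ
    f⁺ zero    = zero
    f⁺ (suc x) = suc (f x)
    f⁺↑ : Monotone f⁺
    f⁺↑ {zero}  {suc y} _         = s≤s z≤n
    f⁺↑ {suc x} {suc y} (s≤s x<y) = s≤s (f↑ x<y)

  -- An increasing final block is determined by the letters before it, so for `q` constantly 1 and
  -- `m ≤ n` this is the number of injective words of length `m` in `n` letters.
  splitSum : ℕ → ℕ → (List ℕ → ℕ) → ℕ
  splitSum n m q = ∑ (perms n) (λ π → q (take m π) * δ (desc 0 (drop m π)) [])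

  ∑-perms-suc : ∀ n f → ∑ (perms (suc n)) f ≡ ∑ (perms n) (λ w → ∑ (insertions 0 (map suc w)) f)
  ∑-perms-suc n f = ∑-concatMap f (λ w → insertions 0 (map suc w)) (perms n)

  -- There is a single increasing permutation of each length, obtained by putting every new minimum
  -- in front.
  splitSum-0 : ∀ n q → splitSum n 0 q ≡ q []
  splitSum-0 zero    q = trans (+-identityʳ (q [] * 1)) (*-identityʳ (q []))
  splitSum-0 (suc n) q = begin
    splitSum (suc n) 0 q
      ≡⟨ ∑-perms-suc n _ ⟩
    ∑ (perms n) (λ w → ∑ (insertions 0 (map suc w)) (λ v → q [] * δ (desc 0 v) []))
      ≡⟨ ∑-cong (λ w → trans (∑-*ˡ (q []) _ (insertions 0 (map suc w)))
           (cong (q [] *_) (∑-insertions-desc 0 w))) (perms n) ⟩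
    splitSum n 0 q
      ≡⟨ splitSum-0 n q ⟩
    q [] ∎
    where open ≡-Reasoning

  -- Pascal's rule. A minimum in the first block is absorbed into the weight; one in the second
  -- block must stand first there and contributes nothing new. Invariance of `q` removes the shift
  -- of the other letters.
  splitSum-suc : ∀ n a q → Invariant q → suc a ≤ n →
    splitSum (suc n) (suc a) q ≡
    splitSum n a (λ u → ∑ (insertions 0 (map suc u)) q) + splitSum n (suc a) q
  splitSum-suc n a q inv a<n = begin
    splitSum (suc n) (suc a) q
      ≡⟨ ∑-perms-suc n _ ⟩
    ∑ (perms n) (λ w → ∑ (insertions 0 (map suc w)) (λ w′ → h (take (suc a) w′) (drop (suc a) w′)))
      ≡⟨ ∑-cong-All (perms-length n) step ⟩
    ∑ (perms n) (λ w → left w + right w)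
      ≡⟨ ∑-+ left right (perms n) ⟩
    ∑ (perms n) left + ∑ (perms n) right ∎
    where
    open ≡-Reasoning
    h : List ℕ → List ℕ → ℕ
    h u v = q u * δ (desc 0 v) []
    left right : List ℕ → ℕ
    left w  = ∑ (insertions 0 (map suc (take a w))) q * δ (desc 0 (drop a w)) []
    right w = q (take (suc a) w) * δ (desc 0 (drop (suc a) w)) []
    step : ∀ w → length w ≡ n →
      ∑ (insertions 0 (map suc w)) (λ w′ → h (take (suc a) w′) (drop (suc a) w′)) ≡
      left w + right w
    step w l = trans
      (∑-insertions-split h 0 a (map suc w)
        (≤-trans a<n (≤-reflexive (sym (trans (length-map suc w) l)))))
      (cong₂ _+_ leftStep rightStep)
      where
      leftStep : ∑ (insertions 0 (take a (map suc w))) (λ u → h u (drop a (map suc w))) ≡ left w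
      leftStep rewrite take-map {f = suc} a w | drop-map {f = suc} a w
                     | desc-map s≤s 0 (drop a w) =
        ∑-*ʳ (δ (desc 0 (drop a w)) []) q (insertions 0 (map suc (take a w)))
      rightStep : ∑ (insertions 0 (drop (suc a) (map suc w))) (λ v → h (take (suc a) (map suc w)) v)
                  ≡ right w
      rightStep rewrite take-map {f = suc} (suc a) w | drop-map {f = suc} (suc a) w
                      | inv s≤s (take (suc a) w) = trans
        (∑-*ˡ (q (take (suc a) w)) (λ v → δ (desc 0 v) []) (insertions 0 (map suc (drop (suc a) w))))
        (cong (q (take (suc a) w) *_) (∑-insertions-desc 0 (drop (suc a) w)))

  splitSum-full : ∀ n q → splitSum n n q ≡ ∑ (perms n) q
  splitSum-full n q = ∑-cong-All (perms-length n) λ w l → trans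
    (cong₂ (λ u v → q u * δ (desc 0 v) [])
      (List.take-all n w (≤-reflexive l)) (List.drop-all n w (≤-reflexive l)))
    (*-identityʳ (q w))

  -- n P′ m counts the injective words of length m in n letters, so that this
  -- is splitSum n m q ≡ n C m * ∑ (perms m) q with the division cleared.
  splitSum-P′ : ∀ n m q → Invariant q → m ≤ n →
                splitSum n m q * m ! ≡ (n P′ m) * ∑ (perms m) q
  splitSum-P′ n zero q inv _ = trans (*-identityʳ (splitSum n 0 q))
    (trans (splitSum-0 n q) (sym (trans (+-identityʳ (q [] + 0)) (+-identityʳ (q [])))))
  splitSum-P′ (suc n) (suc a) q inv (s≤s a≤n) with a ≟ n
  -- Here the second block is empty and cannot receive the minimum, so Pascal's rule does not apply;
  -- `splitSum-suc` asks for `suc a ≤ n`.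
  ... | yes refl = begin
    splitSum (suc a) (suc a) q * suc a !   ≡⟨ cong (_* suc a !) (splitSum-full (suc a) q) ⟩
    ∑ (perms (suc a)) q * suc a !          ≡⟨ *-comm _ (suc a !) ⟩
    suc a ! * ∑ (perms (suc a)) q          ≡⟨ cong (_* ∑ (perms (suc a)) q) (nP′n≡n! (suc a)) ⟨
    (suc a P′ suc a) * ∑ (perms (suc a)) q ∎
    where open ≡-Reasoning
  ... | no a≢n = begin
    splitSum (suc n) (suc a) q * (suc a * a !)
      ≡⟨ cong (_* (suc a * a !)) (splitSum-suc n a q inv a<n) ⟩
    (splitSum n a q′ + splitSum n (suc a) q) * (suc a * a !)
      ≡⟨ *-distribʳ-+ (suc a * a !) (splitSum n a q′) (splitSum n (suc a) q) ⟩
    splitSum n a q′ * (suc a * a !) + splitSum n (suc a) q * suc a !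
      ≡⟨ cong₂ _+_ (x[yz]≡y[xz] (splitSum n a q′) (suc a) (a !))
           (splitSum-P′ n (suc a) q inv a<n) ⟩
    suc a * (splitSum n a q′ * a !) + (n P′ suc a) * S
      ≡⟨ cong (λ t → suc a * t + (n P′ suc a) * S)
           (splitSum-P′ n a q′ (insert-invariant inv) a≤n) ⟩
    suc a * ((n P′ a) * ∑ (perms a) q′) + (n P′ suc a) * S
      -- Summing the inserted weight over `perms a` is summing `q` over `perms (suc a)`, so both
      -- terms share the factor `S`.
      ≡⟨ cong (λ t → suc a * ((n P′ a) * t) + (n P′ suc a) * S) (∑-perms-suc a q) ⟨
    suc a * ((n P′ a) * S) + (n P′ suc a) * S
      ≡⟨ factor (suc a) (n P′ a) (n P′ suc a) S ⟩
    (suc a * (n P′ a) + (n P′ suc a)) * S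
      ≡⟨ cong (_* S) (P′-rec {suc n} {suc a} (s≤s a≤n)) ⟨
    (suc n P′ suc a) * S ∎
    where
    open ≡-Reasoning
    a<n : a < n
    a<n = ≤∧≢⇒< a≤n a≢n
    q′ : List ℕ → ℕ
    q′ u = ∑ (insertions 0 (map suc u)) q
    S : ℕ
    S = ∑ (perms (suc a)) q
    x[yz]≡y[xz] : ∀ x y z → x * (y * z) ≡ y * (x * z)
    x[yz]≡y[xz] = solve-∀
    factor : ∀ x y z s → x * (y * s) + z * s ≡ (x * y + z) * s
    factor = solve-∀

  -- The recurrence for numbers of permutations with given descents

  desc-lower : ∀ j w → All (j ≤_) (desc j w)
  desc-lower j []          = []
  desc-lower j (x ∷ [])    = []
  desc-lower j (x ∷ y ∷ w) with does (y <? x) | desc-lower (suc j) (y ∷ w)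
  ... | true  | ih = ≤-refl ∷ All.map <⇒≤ ih
  ... | false | ih = All.map <⇒≤ ih

  desc-upper : ∀ j x w → All (_< j + length w) (desc j (x ∷ w))
  desc-upper j x []      = []
  desc-upper j x (y ∷ w) with does (y <? x) | desc-upper (suc j) y w
  ... | true  | ih = m<m+n j (s≤s z≤n) ∷ All.map (λ p → ≤-trans p (≤-reflexive (sym (+-suc j (length w))))) ih
  ... | false | ih = All.map (λ p → ≤-trans p (≤-reflexive (sym (+-suc j (length w))))) ih

  -- The list `c` holds the only comparison that neither block sees: the one across the cut, at
  -- index `j + length u`.
  desc-++ : ∀ j x u y v → ∃[ c ] ((c ≡ [] ⊎ c ≡ [ j + length u ]) ×
    desc j ((x ∷ u) ++ y ∷ v) ≡ desc j (x ∷ u) ++ c ++ desc (suc (j + length u)) (y ∷ v))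
  desc-++ j x [] y v rewrite +-identityʳ j with does (y <? x)
  ... | true  = [ j ] , inj₂ refl , refl
  ... | false = []    , inj₁ refl , refl
  desc-++ j x (x′ ∷ u) y v rewrite +-suc j (length u)
    with does (x′ <? x) | desc-++ (suc j) x′ u y v
  ... | true  | c , c∈ , eq = c , c∈ , cong (j ∷_) eq
  ... | false | c , c∈ , eq = c , c∈ , eq

  desc-++-0 : ∀ j x u v →
    desc j (map suc (x ∷ u) ++ 0 ∷ v) ≡
    desc j (map suc (x ∷ u)) ++ j + length u ∷ desc (suc (j + length u)) (0 ∷ v)
  desc-++-0 j x []       v rewrite +-identityʳ j = refl
  desc-++-0 j x (x′ ∷ u) v rewrite +-suc j (length u)
    with does (suc x′ <? suc x) | desc-++-0 (suc j) x′ u v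
  ... | true  | eq = cong (j ∷_) eq
  ... | false | eq = eq

  -- An entry of `Y` exceeds `m` and excludes both deltas on the left. If `Y` is empty, `c` decides
  -- which of the two survives, and in either case the comparison left over is `X` with `D`.
  δ-split : ∀ {m X c Y D} → All (_< m) X → c ≡ [] ⊎ c ≡ [ m ] → All (m <_) Y → All (_< m) D →
            δ (X ++ c ++ Y) (D ∷ʳ m) + δ (X ++ c ++ Y) D ≡ δ X D * δ Y []
  δ-split {m} {X} {c} {y ∷ Y} {D} X<m c∈ (m<y ∷ _) D<m =
    trans (cong₂ _+_ (δ-no ne₁) (δ-no ne₂)) (sym (*-zeroʳ (δ X D)))
    where
    y∈ : y ∈ X ++ c ++ y ∷ Y
    y∈ = ∈-++⁺ʳ X (∈-++⁺ʳ c (here refl))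
    ne₁ : X ++ c ++ y ∷ Y ≢ D ∷ʳ m
    ne₁ eq with ∈-++⁻ D (subst (y ∈_) eq y∈)
    ... | inj₁ y∈D         = <-asym m<y (All.lookup D<m y∈D)
    ... | inj₂ (here refl) = <-irrefl refl m<y
    ne₂ : X ++ c ++ y ∷ Y ≢ D
    ne₂ eq = <-asym m<y (All.lookup D<m (subst (y ∈_) eq y∈))
  δ-split {m} {X} {_} {[]} {D} X<m (inj₁ refl) [] D<m =
    trans (cong₂ _+_ (δ-no ne) (δ-⇔ (trans (sym (++-identityʳ X))) (trans (++-identityʳ X))))
      (sym (*-identityʳ (δ X D)))
    where
    ne : X ++ [] ≢ D ∷ʳ m
    ne eq = <-irrefl refl
      (All.lookup X<m (subst (m ∈_) (trans (sym eq) (++-identityʳ X)) (∈-++⁺ʳ D (here refl))))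
  δ-split {m} {X} {_} {[]} {D} X<m (inj₂ refl) [] D<m =
    trans (cong₂ _+_ (δ-⇔ (List.∷ʳ-injectiveˡ X D) (cong (_∷ʳ m))) (δ-no ne))
      (trans (+-identityʳ (δ X D)) (sym (*-identityʳ (δ X D))))
    where
    ne : X ∷ʳ m ≢ D
    ne eq = <-irrefl refl (All.lookup D<m (subst (m ∈_) eq (∈-++⁺ʳ X (here refl))))

  δ-desc-split : ∀ {m D} w → 0 < m → m < length w → All (_< m) D →
    δ (desc 1 w) (D ∷ʳ m) + δ (desc 1 w) D ≡
    δ (desc 1 (take m w)) D * δ (desc 0 (drop m w)) []
  δ-desc-split {m} {D} w 0<m m<l D<m
    with take m w | drop m w | List.take++drop≡id m w | List.length-take m w | List.length-drop m w
  ... | []    | v     | _    | l₁ | _  = contradiction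
    (≤-reflexive (trans (sym (m≤n⇒m⊓n≡m (<⇒≤ m<l))) (sym l₁))) (<⇒≱ 0<m)
  ... | x ∷ u | []    | _    | _  | l₂ = contradiction (m<n⇒0<n∸m m<l) (<-irrefl l₂)
  ... | x ∷ u | y ∷ v | refl | l₁ | _
    -- With the first letter at index 1, the cut has index `suc (length u)`, which is thereby
    -- identified with `m`.
    with refl ← trans (sym (m≤n⇒m⊓n≡m (<⇒≤ m<l))) (sym l₁)
    with c , c∈ , eq ← desc-++ 1 x u y v
    rewrite eq | sym (δ-desc (suc (suc (length u))) (y ∷ v)) =
    δ-split (desc-upper 1 x u) c∈ (desc-lower (suc (suc (length u))) (y ∷ v)) D<m

  #desc : List ℕ → ℕ → ℕ
  #desc D n = ∑ (perms n) (λ π → δ (desc 1 π) D)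

  -- The condition on the two blocks says nothing about the cut itself, so it covers the words with
  -- and without a descent at `m`. The binomial coefficient is cleared of its denominator `m !`.
  #desc-rec : ∀ {m D n} → 0 < m → m < n → All (_< m) D →
    (#desc (D ∷ʳ m) n + #desc D n) * m ! ≡ (n P′ m) * #desc D m
  #desc-rec {m} {D} {n} 0<m m<n D<m = begin
    (#desc (D ∷ʳ m) n + #desc D n) * m !
      ≡⟨ cong (_* m !) (∑-+ (λ π → δ (desc 1 π) (D ∷ʳ m)) (λ π → δ (desc 1 π) D) (perms n)) ⟨
    ∑ (perms n) (λ π → δ (desc 1 π) (D ∷ʳ m) + δ (desc 1 π) D) * m !
      ≡⟨ cong (_* m !) (∑-cong-All (perms-length n) (λ π l →
           δ-desc-split π 0<m (≤-trans m<n (≤-reflexive (sym l))) D<m)) ⟩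
    splitSum n m (λ u → δ (desc 1 u) D) * m !
      ≡⟨ splitSum-P′ n m _ (λ f↑ u → cong (λ d → δ d D) (desc-map f↑ 1 u)) (<⇒≤ m<n) ⟩
    (n P′ m) * #desc D m ∎
    where open ≡-Reasoning

  #desc-[] : ∀ n → #desc [] n ≡ 1
  #desc-[] n = trans
    (∑-cong (λ π → trans (δ-desc 1 π) (sym (+-identityʳ _))) (perms n))
    (splitSum-0 n (λ _ → 1))

  #desc≤n! : ∀ D n → #desc D n ≤ n !
  #desc≤n! D n = ≤-trans (∑-mono (λ π → δ≤1 (desc 1 π) D) (perms n)) (≤-reflexive (#perms n))

  -- Every admissible descent set is realised

  -- The base case makes all entries positive.
  Decreasing : ℕ → List ℕ → Set
  Decreasing n []      = 0 < n
  Decreasing n (i ∷ D) = i < n × Decreasing i D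

  decreasing⇒0< : ∀ {n} D → Decreasing n D → 0 < n
  decreasing⇒0< []      0<n         = 0<n
  decreasing⇒0< (i ∷ D) (i<n , _)   = ≤-trans (s≤s z≤n) i<n

  decreasing-mono : ∀ {m n} D → m ≤ n → Decreasing m D → Decreasing n D
  decreasing-mono []      m≤n 0<m       = ≤-trans 0<m m≤n
  decreasing-mono (i ∷ D) m≤n (i<m , d) = ≤-trans i<m m≤n , d

  decreasing⇒All< : ∀ {n} D → Decreasing n D → All (_< n) (reverse D)
  decreasing⇒All< []      _         = []
  decreasing⇒All< (i ∷ D) (i<n , d) rewrite List.unfold-reverse i D =
    All.++⁺ (All.map (λ p → <-trans p i<n) (decreasing⇒All< D d)) (i<n ∷ [])

  δ-pos : ∀ {xs ys} → 0 < δ xs ys → xs ≡ ys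
  δ-pos {xs} {ys} 0<δ with xs ≟ˡ ys
  ... | yes eq = eq

  desc-0∷ : ∀ j v → desc 0 v ≡ [] → desc j (0 ∷ map suc v) ≡ []
  desc-0∷ j []       _  = refl
  desc-0∷ j (y ∷ ys) eq = trans (desc-map s≤s (suc j) (y ∷ ys)) (anyIndex (suc j))
    where
    anyIndex : ∀ k → desc k (y ∷ ys) ≡ []
    anyIndex zero    = eq
    anyIndex (suc k) = trans (desc-suc k (y ∷ ys)) (cong (map suc) (anyIndex k))

  ∈-perms-suc : ∀ n {w v} → w ∈ perms n → v ∈ insertions 0 (map suc w) → v ∈ perms (suc n)
  ∈-perms-suc n w∈ v∈ = ∈-concat⁺′ v∈ (∈-map⁺ _ w∈)

  -- Inserting a new minimum after position i creates a descent at i and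
  -- leaves the descents before i unchanged.
  desc-insert-0 : ∀ {i D} w → 0 < i → i ≤ length w →
    desc 1 (take i w) ≡ D → desc 0 (drop i w) ≡ [] →
    desc 1 (map suc (take i w) ++ 0 ∷ map suc (drop i w)) ≡ D ∷ʳ i
  desc-insert-0 {suc a} (x ∷ w) _ (s≤s a≤l) eq₁ eq₂ = begin
    desc 1 (map suc (x ∷ take a w) ++ 0 ∷ map suc (drop a w))
      ≡⟨ desc-++-0 1 x (take a w) (map suc (drop a w)) ⟩
    desc 1 (map suc (x ∷ take a w)) ++
      suc (length (take a w)) ∷ desc (2 + length (take a w)) (0 ∷ map suc (drop a w))
      ≡⟨ cong₂ _++_ (trans (desc-map s≤s 1 (x ∷ take a w)) eq₁)
           (cong₂ _∷_ (cong suc (trans (List.length-take a w) (m≤n⇒m⊓n≡m a≤l)))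
             (desc-0∷ (2 + length (take a w)) (drop a w) eq₂)) ⟩
    _ ∷ʳ suc a ∎
    where open ≡-Reasoning

  -- Induction on the descents, the largest removed together with the letter 0. A permutation with
  -- the remaining descents increases after position `i`, which is where the new minimum goes.
  ∃-perm : ∀ {n} D → Decreasing n D → ∃[ π ] (π ∈ perms n × desc 1 π ≡ reverse D)
  ∃-perm {n} [] _ = ascending n
    where
    ascending : ∀ n → ∃[ π ] (π ∈ perms n × desc 1 π ≡ [])
    ascending zero    = [] , here refl , refl
    ascending (suc n) with ascending n
    ... | w , w∈ , eq = 0 ∷ map suc w , ∈-perms-suc n w∈ (∈-insertions 0 [] (map suc w)) ,
      desc-0∷ 1 w (δ-pos (subst (0 <_) (trans (sym (δ-yes eq)) (δ-desc 1 w)) (s≤s z≤n)))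
  ∃-perm {suc n} (i ∷ D) (s≤s i≤n , d) with ∃-perm {n} D (decreasing-mono D i≤n d)
  ... | w , w∈ , eq =
    map suc (take i w) ++ 0 ∷ map suc (drop i w) ,
    ∈-perms-suc n w∈ (subst (λ l → map suc (take i w) ++ 0 ∷ map suc (drop i w) ∈ insertions 0 l)
      (trans (sym (map-++ suc (take i w) (drop i w))) (cong (map suc) (List.take++drop≡id i w)))
      (∈-insertions 0 (map suc (take i w)) (map suc (drop i w)))) ,
    trans (desc-insert-0 w 0<i (≤-trans i≤n (≤-reflexive (sym l))) (proj₁ parts) (proj₂ parts))
      (sym (List.unfold-reverse i D))
    where
    l : length w ≡ n
    l = All.lookup (perms-length n) w∈
    0<i : 0 < i
    0<i = decreasing⇒0< D d
    parts : desc 1 (take i w) ≡ reverse D × desc 0 (drop i w) ≡ []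
    parts with i ≟ n
    ... | yes refl rewrite List.take-all i w (≤-reflexive l) | List.drop-all i w (≤-reflexive l) =
      eq , refl
    -- As `desc 1 w` equals `reverse D`, the left side of `δ-desc-split` is positive, hence so are
    -- both factors of the product on its right.
    ... | no i≢n = δ-pos (>-nonZero⁻¹ _ {{m*n≢0⇒m≢0 _ {{both}}}}) ,
                   δ-pos (>-nonZero⁻¹ _ {{m*n≢0⇒n≢0 (δ (desc 1 (take i w)) (reverse D)) {{both}}}})
      where
      both : NonZero (δ (desc 1 (take i w)) (reverse D) * δ (desc 0 (drop i w)) [])
      both = subst NonZero
        (δ-desc-split w 0<i (≤-trans (≤∧≢⇒< i≤n i≢n) (≤-reflexive (sym l))) (decreasing⇒All< D d))
        (>-nonZero (≤-trans (≤-reflexive (sym (δ-yes eq))) (m≤n+m _ _)))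

  #desc-pos : ∀ {n} D → Decreasing n D → 0 < #desc (reverse D) n
  #desc-pos D d with ∃-perm D d
  ... | π , π∈ , eq = ≤-trans (≤-reflexive (sym (δ-yes eq))) (∈⇒≤∑ _ π∈)

  -- From one-line notation to lists of naturals

  letters : ∀ {n k} → Vec (Fin n) k → List ℕ
  letters Vec.[]      = []
  letters (x Vec.∷ w) = toℕ x ∷ letters w

  letters-injective : ∀ {n k} {v w : Vec (Fin n) k} → letters v ≡ letters w → v ≡ w
  letters-injective {v = Vec.[]}    {Vec.[]}    _  = refl
  letters-injective {v = x Vec.∷ v} {y Vec.∷ w} eq =
    cong₂ Vec._∷_ (toℕ-injective (List.∷-injectiveˡ eq)) (letters-injective (List.∷-injectiveʳ eq))

  descentsFrom-letters : ∀ {n k} j (w : Vec (Fin n) k) → descentsFrom j w ≡ desc j (letters w)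
  descentsFrom-letters j Vec.[]              = refl
  descentsFrom-letters j (x Vec.∷ Vec.[])    = refl
  descentsFrom-letters j (x Vec.∷ y Vec.∷ w)
    rewrite descentsFrom-letters (suc j) (y Vec.∷ w) = refl

  letters-isPerm : ∀ {n k} (w : Vec (Fin n) k) → VecUnique w →
                   Unique (letters w) × All (_< n) (letters w) × length (letters w) ≡ k
  letters-isPerm Vec.[]      VecPairs.[] = [] , [] , refl
  letters-isPerm (x Vec.∷ w) (x∉ VecPairs.∷ u) with letters-isPerm w u
  ... | u′ , b , l = fresh w x∉ ∷ u′ , toℕ<n x ∷ b , cong suc l
    where
    fresh : ∀ {k} (w : Vec _ k) → VecAll.All (x ≢_) w → All (toℕ x ≢_) (letters w)
    fresh Vec.[]      VecAll.[]           = []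
    fresh (y Vec.∷ w) (x≢y VecAll.∷ x∉w) = x≢y ∘ toℕ-injective ∷ fresh w x∉w

  isPerm-letters : ∀ {n k π} → Unique π → All (_< n) π → length π ≡ k →
                   ∃[ w ] (VecUnique {A = Fin n} {n = k} w × π ≡ letters w)
  isPerm-letters {k = zero}  {[]}    _        _         _ = Vec.[] , VecPairs.[] , refl
  isPerm-letters {k = suc k} {x ∷ π} (x∉ ∷ u) (x<n ∷ b) l
    with isPerm-letters u b (suc-injective l)
  ... | w , u′ , refl = fromℕ< x<n Vec.∷ w , fresh w x∉ VecPairs.∷ u′ ,
                        cong (_∷ letters w) (sym (toℕ-fromℕ< x<n))
    where
    fresh : ∀ {k} (w : Vec _ k) → All (x ≢_) (letters w) → VecAll.All (fromℕ< x<n ≢_) w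
    fresh Vec.[]      []          = VecAll.[]
    fresh (y Vec.∷ w) (x≢y ∷ x∉w) =
      (λ { refl → x≢y (sym (toℕ-fromℕ< x<n)) }) VecAll.∷ fresh w x∉w

  ∈-words : ∀ {n k} (w : Vec (Fin n) k) → w ∈ words n k
  ∈-words Vec.[]      = here refl
  ∈-words (x Vec.∷ w) = ∈-cartesianProductWith⁺ Vec._∷_ (∈-allFin x) (∈-words w)

  words-unique : ∀ n k → Unique (words n k)
  words-unique n zero    = [] ∷ []
  words-unique n (suc k) = Unique.cartesianProductWith⁺ Vec._∷_ (λ { refl → refl , refl })
    (Unique.allFin⁺ n) (words-unique n k)

  permutationWords : ∀ n → List (Vec (Fin n) n)
  permutationWords n = filter unique? (words n n)

  -- Two lists without repetitions and with the same members are rearrangements of each other, and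
  -- sums do not see the order.
  permutationWords-↭ : ∀ n → map letters (permutationWords n) ↭ perms n
  permutationWords-↭ n = ∼bag⇒↭ (unique∧set⇒bag
    (Unique.map⁺ letters-injective (Unique.filter⁺ unique? (words-unique n n)))
    (perms-unique n)
    (mk⇔ to from))
    where
    to : ∀ {π} → π ∈ map letters (permutationWords n) → π ∈ perms n
    to π∈ with ∈-map⁻ letters π∈
    ... | w , w∈ , refl =
      isPerm⇒∈perms n (letters-isPerm w (proj₂ (∈-filter⁻ unique? {xs = words n n} w∈)))
    from : ∀ {π} → π ∈ perms n → π ∈ map letters (permutationWords n)
    from π∈ with All.lookup (perms-isPerm n) π∈
    ... | u , b , l with isPerm-letters u b l
    ...   | w , u′ , refl = ∈-map⁺ letters (∈-filter⁺ unique? (∈-words w) u′)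

  #permutations≡#desc : ∀ I n → #permutations I n ≡ #desc (elements I) n
  #permutations≡#desc I n = begin
    length (filter (isPermutationWithDescents? I) (words n n))
      ≡⟨ count (words n n) ⟩
    ∑ (permutationWords n) (λ w → δ (descents w) (elements I))
      ≡⟨ ∑-cong (λ w → cong (λ d → δ d (elements I)) (descentsFrom-letters 1 w)) (permutationWords n) ⟩
    ∑ (permutationWords n) (λ w → δ (desc 1 (letters w)) (elements I))
      ≡⟨ ∑-map (λ π → δ (desc 1 π) (elements I)) letters (permutationWords n) ⟨
    ∑ (map letters (permutationWords n)) (λ π → δ (desc 1 π) (elements I))
      ≡⟨ sum-↭ (map⁺ _ (permutationWords-↭ n)) ⟩
    #desc (elements I) n ∎
    where
    open ≡-Reasoning
    count : ∀ ws → length (filter (isPermutationWithDescents? I) ws) ≡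
                   ∑ (filter unique? ws) (λ w → δ (descents w) (elements I))
    count []       = refl
    count (w ∷ ws) with unique? w
    ... | no  _ = count ws
    ... | yes _ with does (descents w ≟ˡ elements I)
    ...   | true  = cong suc (count ws)
    ...   | false = count ws

  -- The elements of a positive set, largest first

  allPairs-∷ʳ⁻ : ∀ xs {x : ℕ} → AllPairs _<_ (xs ∷ʳ x) → AllPairs _<_ xs × All (_< x) xs
  allPairs-∷ʳ⁻ []       _          = [] , []
  allPairs-∷ʳ⁻ (y ∷ xs) (y< ∷ xs<) with allPairs-∷ʳ⁻ xs xs<
  ... | p , q = All.++⁻ˡ xs y< ∷ p , All.head (All.++⁻ʳ xs y<) ∷ q

  increasing⇒decreasing : ∀ {n} D → 0 < n → AllPairs _<_ (reverse D) → All (0 <_) (reverse D) →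
                          All (_< n) (reverse D) → Decreasing n D
  increasing⇒decreasing []      0<n _ _ _ = 0<n
  increasing⇒decreasing (i ∷ D) 0<n p q r rewrite List.unfold-reverse i D
    with allPairs-∷ʳ⁻ (reverse D) p
  ... | p′ , D<i = All.head (All.++⁻ʳ (reverse D) r) ,
    increasing⇒decreasing D (All.head (All.++⁻ʳ (reverse D) q)) p′ (All.++⁻ˡ (reverse D) q) D<i

  max-reverse : ∀ m D → Decreasing m D → Extrema.max 0 (reverse (m ∷ D)) ≡ m
  max-reverse m D d rewrite List.unfold-reverse m D = ≤-antisym
    (Extrema.max≤v⁺ z≤n (All.++⁺ (All.map <⇒≤ (decreasing⇒All< D d)) (≤-refl ∷ [])))
    (All.lookup (Extrema.xs≤max 0 (reverse D ∷ʳ m)) (∈-++⁺ʳ (reverse D) (here refl)))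

  ∖max-reverse : ∀ I {m D} → elements I ≡ reverse (m ∷ D) → Decreasing m D →
                 elements (I ∖max) ≡ reverse D
  ∖max-reverse I {m} {D} eq d = begin
    filter (≢max? I) (elements I)
      ≡⟨ cong (filter (≢max? I)) (trans eq (List.unfold-reverse m D)) ⟩
    filter (≢max? I) (reverse D ∷ʳ m)
      ≡⟨ List.filter-++ (≢max? I) (reverse D) [ m ] ⟩
    filter (≢max? I) (reverse D) ++ filter (≢max? I) [ m ]
      ≡⟨ cong₂ _++_
           (List.filter-all (≢max? I)
             (All.map (λ x<m x≡ → <-irrefl (trans x≡ max≡m) x<m) (decreasing⇒All< D d)))
           (List.filter-reject (≢max? I) (λ m≢ → m≢ (sym max≡m))) ⟩
    reverse D ++ []
      ≡⟨ ++-identityʳ (reverse D) ⟩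
    reverse D ∎
    where
    open ≡-Reasoning
    max≡m : max I ≡ m
    max≡m = trans (cong (Extrema.max 0) eq) (max-reverse m D d)

  -- Largest first, the recursion on I⁻ is recursion on the tail of the list, and `m` and m⁻ are its
  -- first two entries.
  reversed-elements : ∀ I → 2 ≤ # I → ∃[ L ]
    (elements I ≡ reverse (max I ∷ max (I ∖max) ∷ L) × Decreasing (max I) (max (I ∖max) ∷ L))
  reversed-elements I 2≤#I = go (reverse (elements I)) (sym (List.reverse-involutive (elements I)))
    where
    go : ∀ D → elements I ≡ reverse D → ∃[ L ]
      (elements I ≡ reverse (max I ∷ max (I ∖max) ∷ L) × Decreasing (max I) (max (I ∖max) ∷ L))
    go []      eq with () ← ≤-trans 2≤#I (≤-reflexive (cong length eq))
    go (_ ∷ []) eq with s≤s () ← ≤-trans 2≤#I (≤-reflexive (cong length eq))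
    go (m ∷ m⁻ ∷ L) eq = L ,
      trans eq (cong₂ (λ x y → reverse (x ∷ y ∷ L)) (sym max≡m) (sym max⁻≡m⁻)) ,
      subst₂ (λ x y → Decreasing x (y ∷ L)) (sym max≡m) (sym max⁻≡m⁻) (proj₂ dec)
      where
      -- A provisional strict bound on all elements, available before the head of the list is
      -- identified with the maximum.
      bound : ℕ
      bound = suc (max I)
      dec : m < bound × Decreasing m (m⁻ ∷ L)
      dec = increasing⇒decreasing (m ∷ m⁻ ∷ L) (s≤s z≤n)
        (subst (AllPairs _<_) eq (Linked.Linked⇒AllPairs <-trans (increasing I)))
        (subst (All (0 <_)) eq (positive I))
        (subst (All (_< bound)) eq (All.map s≤s (Extrema.xs≤max 0 (elements I))))
      max≡m : max I ≡ m
      max≡m = trans (cong (Extrema.max 0) eq) (max-reverse m (m⁻ ∷ L) (proj₂ dec))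
      max⁻≡m⁻ : max (I ∖max) ≡ m⁻
      max⁻≡m⁻ = trans (cong (Extrema.max 0) (∖max-reverse I eq (proj₂ dec)))
        (max-reverse m⁻ L (proj₂ (proj₂ dec)))

open Combinatorics using
  (Decreasing; decreasing-mono; decreasing⇒0<; decreasing⇒All<; #desc; #desc-[]; #desc-rec;
   #desc-pos; #desc≤n!; #permutations≡#desc; reversed-elements)

-- A ring solver with integer coefficients

module IntegerSolver {c ℓ} (R : CommutativeRing c ℓ) where
  open import Algebra.Solver.Ring.AlmostCommutativeRing
    using (fromCommutativeRing; _-Raw-AlmostCommutative⟶_)
  open import Algebra.Properties.Semiring.Mult.TCOptimised (CommutativeRing.semiring R)
    using (×-homo-+; ×1-homo-*) renaming (_×_ to _·_)
  open import Algebra.Solver.Ring.NaturalCoefficients.Default (CommutativeRing.commutativeSemiring R)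
    using (solve; _:=_; _:+_; _:*_)
  open import Data.Maybe.Base using (Maybe; just; nothing)
  open CommutativeRing R
  open import Relation.Binary.Reasoning.Setoid setoid

  -- The coefficient (a , b) stands for the integer a - b.
  private
    pairs : RawRing _ _
    pairs = record
      { Carrier = ℕ × ℕ
      ; _≈_     = _≡_
      ; _+_     = λ (a , b) (c , d) → a ℕ.+ c , b ℕ.+ d
      ; _*_     = λ (a , b) (c , d) → a ℕ.* c ℕ.+ b ℕ.* d , a ℕ.* d ℕ.+ b ℕ.* c
      ; -_      = λ (a , b) → b , a
      ; 0#      = 0 , 0
      ; 1#      = 1 , 0
      }

    open RawRing pairs using () renaming (_+_ to _⊕_; _*_ to _⊗_; -_ to ⊝_)

    ⟦_⟧ : ℕ × ℕ → Carrier
    ⟦ a , b ⟧ = a · 1# - b · 1#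

    moveʳ : ∀ {x y z} → x ≈ z + y → x - y ≈ z
    moveʳ {x} {y} {z} eq = begin
      x - y         ≈⟨ +-congʳ eq ⟩
      (z + y) - y   ≈⟨ +-assoc z y (- y) ⟩
      z + (y - y)   ≈⟨ +-congˡ (-‿inverseʳ y) ⟩
      z + 0#        ≈⟨ +-identityʳ z ⟩
      z ∎

    moveˡ : ∀ x y → x ≈ (x - y) + y
    moveˡ x y = sym (begin
      (x - y) + y   ≈⟨ +-assoc x (- y) y ⟩
      x + (- y + y) ≈⟨ +-congˡ (-‿inverseˡ y) ⟩
      x + 0#        ≈⟨ +-identityʳ x ⟩
      x ∎)

    +-homo : ∀ p q → ⟦ p ⊕ q ⟧ ≈ ⟦ p ⟧ + ⟦ q ⟧
    +-homo (a , b) (c , d) = moveʳ (begin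
      (a ℕ.+ c) · 1#      ≈⟨ ×-homo-+ 1# a c ⟩
      a · 1# + c · 1#     ≈⟨ +-cong (moveˡ (a · 1#) (b · 1#)) (moveˡ (c · 1#) (d · 1#)) ⟩
      (⟦ a , b ⟧ + b · 1#) + (⟦ c , d ⟧ + d · 1#)
        ≈⟨ solve 4 (λ p b q d → (p :+ b) :+ (q :+ d) := (p :+ q) :+ (b :+ d)) refl
             ⟦ a , b ⟧ (b · 1#) ⟦ c , d ⟧ (d · 1#) ⟩
      (⟦ a , b ⟧ + ⟦ c , d ⟧) + (b · 1# + d · 1#)
        ≈⟨ +-congˡ (×-homo-+ 1# b d) ⟨
      (⟦ a , b ⟧ + ⟦ c , d ⟧) + (b ℕ.+ d) · 1# ∎)

    +*-homo : ∀ a b c d → (a ℕ.* b ℕ.+ c ℕ.* d) · 1# ≈ a · 1# * b · 1# + c · 1# * d · 1#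
    +*-homo a b c d =
      trans (×-homo-+ 1# (a ℕ.* b) (c ℕ.* d)) (+-cong (×1-homo-* a b) (×1-homo-* c d))

    *-homo : ∀ p q → ⟦ p ⊗ q ⟧ ≈ ⟦ p ⟧ * ⟦ q ⟧
    *-homo (a , b) (c , d) = moveʳ (begin
      (a ℕ.* c ℕ.+ b ℕ.* d) · 1#
        ≈⟨ +*-homo a c b d ⟩
      a · 1# * c · 1# + B * D
        ≈⟨ +-congʳ (*-cong (moveˡ (a · 1#) B) (moveˡ (c · 1#) D)) ⟩
      (P + B) * (Q + D) + B * D
        ≈⟨ solve 4 (λ p b q d → (p :+ b) :* (q :+ d) :+ b :* d :=
             p :* q :+ ((p :+ b) :* d :+ b :* (q :+ d))) refl P B Q D ⟩
      P * Q + ((P + B) * D + B * (Q + D))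
        ≈⟨ +-congˡ (+-cong (*-congʳ (moveˡ (a · 1#) B)) (*-congˡ (moveˡ (c · 1#) D))) ⟨
      P * Q + (a · 1# * D + B * c · 1#)
        ≈⟨ +-congˡ (+*-homo a d b c) ⟨
      P * Q + (a ℕ.* d ℕ.+ b ℕ.* c) · 1# ∎)
      where
      B D P Q : Carrier
      B = b · 1#
      D = d · 1#
      P = ⟦ a , b ⟧
      Q = ⟦ c , d ⟧

    -‿homo : ∀ p → ⟦ ⊝ p ⟧ ≈ - ⟦ p ⟧
    -‿homo (a , b) = moveʳ (begin
      b · 1#                              ≈⟨ +-identityˡ (b · 1#) ⟨
      0# + b · 1#                         ≈⟨ +-congʳ (-‿inverseˡ ⟦ a , b ⟧) ⟨
      (- ⟦ a , b ⟧ + ⟦ a , b ⟧) + b · 1#   ≈⟨ +-assoc _ _ _ ⟩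
      - ⟦ a , b ⟧ + (⟦ a , b ⟧ + b · 1#)   ≈⟨ +-congˡ (moveˡ (a · 1#) (b · 1#)) ⟨
      - ⟦ a , b ⟧ + a · 1# ∎)

    -- Agrees with ⟦_⟧, but 0 and 1 are interpreted by 0# and 1# on the nose.
    ⟦_⟧′ : ℕ × ℕ → Carrier
    ⟦ a , ℕ.zero    ⟧′ = a · 1#
    ⟦ a , b@(ℕ.suc _) ⟧′ = ⟦ a , b ⟧

    ′≈ : ∀ p → ⟦ p ⟧′ ≈ ⟦ p ⟧
    ′≈ (a , ℕ.zero)  = sym (moveʳ (sym (+-identityʳ (a · 1#))))
    ′≈ (a , ℕ.suc b) = refl

    homomorphism : pairs -Raw-AlmostCommutative⟶ fromCommutativeRing R
    homomorphism = record
      { ⟦_⟧    = ⟦_⟧′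
      ; +-homo = λ p q → trans (′≈ (p ⊕ q)) (trans (+-homo p q) (sym (+-cong (′≈ p) (′≈ q))))
      ; *-homo = λ p q → trans (′≈ (p ⊗ q)) (trans (*-homo p q) (sym (*-cong (′≈ p) (′≈ q))))
      ; -‿homo = λ p → trans (′≈ (⊝ p)) (trans (-‿homo p) (sym (-‿cong (′≈ p))))
      ; 0-homo = refl
      ; 1-homo = refl
      }

    -- The pairs are not reduced, so integer equality is tested crosswise. A negative answer asserts
    -- nothing, since distinct integers may coincide in the ring.
    _≟ᵖ_ : ∀ p q → Maybe (⟦ p ⟧′ ≈ ⟦ q ⟧′)
    p@(a , b) ≟ᵖ q@(c , d) with a ℕ.+ d ℕ.≟ c ℕ.+ b
    ... | no  _  = nothing
    ... | yes eq = just (trans (′≈ p) (trans (moveʳ (begin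
      A              ≈⟨ moveʳ refl ⟨
      (A + D) - D    ≈⟨ +-congʳ (×-homo-+ 1# a d) ⟨
      (a ℕ.+ d) · 1# - D
        ≡⟨ ≡.cong (λ n → n · 1# - D) eq ⟩
      (c ℕ.+ b) · 1# - D
        ≈⟨ moveʳ (begin
             (c ℕ.+ b) · 1# ≈⟨ ×-homo-+ 1# c b ⟩
             c · 1# + B     ≈⟨ +-congʳ (moveˡ (c · 1#) D) ⟩
             (Q + D) + B    ≈⟨ solve 3 (λ q d b → (q :+ d) :+ b := (q :+ b) :+ d) refl Q D B ⟩
             (Q + B) + D    ∎) ⟩
      Q + B          ∎)) (sym (′≈ q))))
      where
      A B D Q : Carrier
      A = a · 1#
      B = b · 1#
      D = d · 1#
      Q = ⟦ c , d ⟧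

  open import Algebra.Solver.Ring pairs (fromCommutativeRing R) homomorphism _≟ᵖ_ public

-- Inequalities in an ordered field

module OrderedField {c ℓ} (ℝ : RealNumbers c ℓ) where
  open RealNumbers ℝ
  open Roots ℝ using (square-nonNeg; fromℕ-nonNeg)
  open IntegerSolver commutativeRing
  open import Algebra.Properties.Semiring.Mult semiring using (×1-homo-*; ×-homo-+)

  resp : ∀ {a b x y} → a ≈ b → x ≈ y → a ≤ x → b ≤ y
  resp a≈b x≈y a≤x = ≤-trans (≤-reflexive (sym a≈b)) (≤-trans a≤x (≤-reflexive x≈y))

  ≰⇒≥ : ∀ {x y} → ¬ x ≤ y → y ≤ x
  ≰⇒≥ {x} {y} x≰y with total x y
  ... | inj₁ x≤y = contradiction x≤y x≰y
  ... | inj₂ y≤x = y≤x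

  +-mono-≤ : ∀ {w x y z} → w ≤ x → y ≤ z → w + y ≤ x + z
  +-mono-≤ {w} {x} {y} {z} w≤x y≤z =
    ≤-trans (+-monoˡ-≤ y w≤x) (resp (+-comm y x) (+-comm z x) (+-monoˡ-≤ x y≤z))

  0≤y-x : ∀ {x y} → x ≤ y → 0# ≤ y - x
  0≤y-x {x} x≤y = resp (-‿inverseʳ x) refl (+-monoˡ-≤ (- x) x≤y)

  0≤y-x⇒x≤y : ∀ {x y} → 0# ≤ y - x → x ≤ y
  0≤y-x⇒x≤y {x} {y} p = resp (+-identityˡ x)
    (solve 2 (λ x y → (y :- x) :+ x := y) refl x y) (+-monoˡ-≤ x p)

  +-cancelʳ-≤ : ∀ {x y} z → x + z ≤ y + z → x ≤ y
  +-cancelʳ-≤ {x} {y} z p = resp (cancel x z) (cancel y z) (+-monoˡ-≤ (- z) p)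
    where
    cancel : ∀ x z → (x + z) - z ≈ x
    cancel = solve 2 (λ x z → (x :+ z) :- z := x) refl

  +-nonNeg : ∀ {x y} → 0# ≤ x → 0# ≤ y → 0# ≤ x + y
  +-nonNeg 0≤x 0≤y = resp (+-identityˡ 0#) refl (+-mono-≤ 0≤x 0≤y)

  *-monoˡ-≤ : ∀ {z x y} → 0# ≤ z → x ≤ y → z * x ≤ z * y
  *-monoˡ-≤ {z} {x} {y} 0≤z x≤y = 0≤y-x⇒x≤y (resp refl
    (solve 3 (λ x y z → z :* (y :- x) := z :* y :- z :* x) refl x y z)
    (*-nonNeg 0≤z (0≤y-x x≤y)))

  *-monoʳ-≤ : ∀ {z x y} → 0# ≤ z → x ≤ y → x * z ≤ y * z
  *-monoʳ-≤ 0≤z x≤y = resp (*-comm _ _) (*-comm _ _) (*-monoˡ-≤ 0≤z x≤y)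

  *-cancelˡ-≈0 : ∀ {x y} → ¬ x ≈ 0# → x * y ≈ 0# → y ≈ 0#
  *-cancelˡ-≈0 {x} {y} x≉0 xy≈0 with invertible x x≉0
  ... | i , xi≈1 = begin
    y             ≈⟨ *-identityˡ y ⟨
    1# * y        ≈⟨ *-congʳ xi≈1 ⟨
    x * i * y     ≈⟨ solve 3 (λ x i y → x :* i :* y := i :* (x :* y)) refl x i y ⟩
    i * (x * y)   ≈⟨ *-congˡ xy≈0 ⟩
    i * 0#        ≈⟨ zeroʳ i ⟩
    0# ∎
    where open import Relation.Binary.Reasoning.Setoid setoid

  -- Strict positivity is expressed as `¬ x ≤ 0#`, here and below; decidability of `≤` allows
  -- passing back to inequalities.
  *-pos : ∀ {x y} → ¬ x ≤ 0# → ¬ y ≤ 0# → ¬ x * y ≤ 0#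
  *-pos x≰0 y≰0 xy≤0 = y≰0 (≤-reflexive (*-cancelˡ-≈0
    (λ x≈0 → x≰0 (≤-reflexive x≈0))
    (antisym xy≤0 (*-nonNeg (≰⇒≥ x≰0) (≰⇒≥ y≰0)))))

  *-cancelˡ-≤ : ∀ {z x y} → ¬ z ≤ 0# → z * x ≤ z * y → x ≤ y
  *-cancelˡ-≤ {z} {x} {y} z≰0 zx≤zy = decidable-stable (x ≤? y) λ x≰y → *-pos z≰0
    (λ x-y≤0 → x≰y (resp
      (solve 2 (λ x y → (x :- y) :+ y := x) refl x y) (+-identityˡ y) (+-monoˡ-≤ y x-y≤0)))
    (resp (solve 3 (λ x y z → z :* x :- z :* y := z :* (x :- y)) refl x y z)
      (-‿inverseʳ (z * y)) (+-monoˡ-≤ (- (z * y)) zx≤zy))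

  0≤1 : 0# ≤ 1#
  0≤1 = resp refl (*-identityˡ 1#) (square-nonNeg 1#)

  1≰0 : ¬ 1# ≤ 0#
  1≰0 1≤0 = 0≉1 (antisym 0≤1 1≤0)

  1≤⇒≰0 : ∀ {x} → 1# ≤ x → ¬ x ≤ 0#
  1≤⇒≰0 1≤x x≤0 = 1≰0 (≤-trans 1≤x x≤0)

  square-cancel-≤ : ∀ {x y} → 0# ≤ y → x * x ≤ y * y → x ≤ y
  square-cancel-≤ {x} {y} 0≤y x²≤y² = decidable-stable (x ≤? y) λ x≰y →
    x≰y (*-cancelˡ-≤ (λ x≤0 → x≰y (≤-trans x≤0 0≤y))
      (≤-trans x²≤y² (*-monoʳ-≤ 0≤y (≰⇒≥ x≰y))))

  square-cancel-≈ : ∀ {x y} → 0# ≤ x → 0# ≤ y → x * x ≈ y * y → x ≈ y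
  square-cancel-≈ 0≤x 0≤y eq = antisym
    (square-cancel-≤ 0≤y (≤-reflexive eq)) (square-cancel-≤ 0≤x (≤-reflexive (sym eq)))

  x≤x+y : ∀ {x y} → 0# ≤ y → x ≤ x + y
  x≤x+y {x} 0≤y = resp (+-identityʳ x) refl (+-mono-≤ ≤-refl 0≤y)

  fromℕ-+ : ∀ m n → fromℕ (m ℕ.+ n) ≈ fromℕ m + fromℕ n
  fromℕ-+ = ×-homo-+ 1#

  fromℕ-* : ∀ m n → fromℕ (m ℕ.* n) ≈ fromℕ m * fromℕ n
  fromℕ-* = ×1-homo-*

  fromℕ-mono-≤ : ∀ {m n} → m ℕ.≤ n → fromℕ m ≤ fromℕ n
  fromℕ-mono-≤ {n = n} z≤n = fromℕ-nonNeg n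
  fromℕ-mono-≤ (s≤s m≤n)   = +-mono-≤ ≤-refl (fromℕ-mono-≤ m≤n)

  1≤fromℕ : ∀ {n} → 0 < n → 1# ≤ fromℕ n
  1≤fromℕ 0<n = resp (+-identityʳ 1#) refl (fromℕ-mono-≤ 0<n)

  fromℕ-∸ : ∀ {m n} → m ℕ.≤ n → fromℕ (n ∸ m) ≈ fromℕ n - fromℕ m
  fromℕ-∸ {m} {n} m≤n = begin
    fromℕ (n ∸ m)
      ≈⟨ solve 2 (λ d m → d := (m :+ d) :- m) refl (fromℕ (n ∸ m)) (fromℕ m) ⟩
    (fromℕ m + fromℕ (n ∸ m)) - fromℕ m
      ≈⟨ +-congʳ (fromℕ-+ m (n ∸ m)) ⟨
    fromℕ (m ℕ.+ (n ∸ m)) - fromℕ m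
      ≡⟨ ≡.cong (λ k → fromℕ k - fromℕ m) (ℕ.m+[n∸m]≡n m≤n) ⟩
    fromℕ n - fromℕ m ∎
    where open import Relation.Binary.Reasoning.Setoid setoid

  ⊓-sel : ∀ x y → x ⊓ y ≡ x ⊎ x ⊓ y ≡ y
  ⊓-sel x y with total x y
  ... | inj₁ _ = inj₁ ≡.refl
  ... | inj₂ _ = inj₂ ≡.refl

  y≤x⊔y : ∀ x y → y ≤ x ⊔ y
  y≤x⊔y x y with total y x
  ... | inj₁ y≤x = y≤x
  ... | inj₂ _   = ≤-refl

  ⊔-lub : ∀ {x y u} → x ≤ u → y ≤ u → x ⊔ y ≤ u
  ⊔-lub {x} {y} x≤u y≤u with total y x
  ... | inj₁ _ = x≤u
  ... | inj₂ _ = y≤u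

  *-cancelˡ-≈ : ∀ {z x y} → ¬ z ≤ 0# → z * x ≈ z * y → x ≈ y
  *-cancelˡ-≈ z≰0 eq = antisym
    (*-cancelˡ-≤ z≰0 (≤-reflexive eq)) (*-cancelˡ-≤ z≰0 (≤-reflexive (sym eq)))

  -- Used backwards: a nonnegative number with a positive power that is at least 1 is itself at
  -- least 1.
  ^-≤self : ∀ r .{{_ : NonZero r}} {x} → 0# ≤ x → x ≤ 1# → x ^ r ≤ x
  ^-≤self (suc zero)    0≤x x≤1 = ≤-reflexive (*-identityʳ _)
  ^-≤self (suc (suc r)) 0≤x x≤1 = resp refl (*-identityʳ _)
    (*-monoˡ-≤ 0≤x (≤-trans (^-≤self (suc r) 0≤x x≤1) x≤1))

-- The modulus of a complex number

module Modulus {c ℓ} (ℝ : RealNumbers c ℓ) where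
  open RealNumbers ℝ
  open Roots ℝ
  open Complex ℝ
  open OrderedField ℝ
  open IntegerSolver commutativeRing
  open import Relation.Binary.Reasoning.Setoid setoid

  ∣∣²  : ∀ z → ∣ z ∣ᶜ * ∣ z ∣ᶜ ≈ Re z * Re z + Im z * Im z
  ∣∣² z = trans (*-congˡ (sym (*-identityʳ ∣ z ∣ᶜ)))
    (root-^ 2 (Re z * Re z + Im z * Im z) (sumOfSquares-nonNeg (Re z) (Im z)))

  ∣∣-nonNeg : ∀ z → 0# ≤ ∣ z ∣ᶜ
  ∣∣-nonNeg z = root-nonNeg 2 (Re z * Re z + Im z * Im z) (sumOfSquares-nonNeg (Re z) (Im z))

  ∣∣-unique : ∀ z {r} → 0# ≤ r → Re z * Re z + Im z * Im z ≈ r * r → ∣ z ∣ᶜ ≈ r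
  ∣∣-unique z 0≤r eq = square-cancel-≈ (∣∣-nonNeg z) 0≤r (trans (∣∣² z) eq)

  ∣∣-cong : ∀ {z w} → z ≈ᶜ w → ∣ z ∣ᶜ ≈ ∣ w ∣ᶜ
  ∣∣-cong {z} {w} (p , q) = ∣∣-unique z (∣∣-nonNeg w)
    (trans (+-cong (*-cong p p) (*-cong q q)) (sym (∣∣² w)))

  ∣∣-real : ∀ {x} → 0# ≤ x → ∣ x +i 0# ∣ᶜ ≈ x
  ∣∣-real {x} 0≤x = ∣∣-unique (x +i 0#) 0≤x
    (trans (+-congˡ (zeroˡ 0#)) (+-identityʳ (x * x)))

  -- The two-square identity of Brahmagupta, followed by a square root.
  ∣∣-* : ∀ z w → ∣ z *ᶜ w ∣ᶜ ≈ ∣ z ∣ᶜ * ∣ w ∣ᶜ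
  ∣∣-* z@(a +i b) w@(c +i d) = ∣∣-unique (z *ᶜ w) (*-nonNeg (∣∣-nonNeg z) (∣∣-nonNeg w)) (begin
    (a * c - b * d) * (a * c - b * d) + (a * d + b * c) * (a * d + b * c)
      ≈⟨ solve 4 (λ a b c d →
           (a :* c :- b :* d) :* (a :* c :- b :* d) :+ (a :* d :+ b :* c) :* (a :* d :+ b :* c) :=
           (a :* a :+ b :* b) :* (c :* c :+ d :* d)) refl a b c d ⟩
    (a * a + b * b) * (c * c + d * d)
      ≈⟨ *-cong (∣∣² z) (∣∣² w) ⟨
    (∣ z ∣ᶜ * ∣ z ∣ᶜ) * (∣ w ∣ᶜ * ∣ w ∣ᶜ)
      ≈⟨ solve 2 (λ x y → (x :* x) :* (y :* y) := (x :* y) :* (x :* y)) refl ∣ z ∣ᶜ ∣ w ∣ᶜ ⟩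
    (∣ z ∣ᶜ * ∣ w ∣ᶜ) * (∣ z ∣ᶜ * ∣ w ∣ᶜ) ∎)

  -- Lagrange's identity: the difference of the two squares is the square of `a * d - b * c`.
  cauchy-schwarz : ∀ z w → Re z * Re w + Im z * Im w ≤ ∣ z ∣ᶜ * ∣ w ∣ᶜ
  cauchy-schwarz z@(a +i b) w@(c +i d) = square-cancel-≤
    (*-nonNeg (∣∣-nonNeg z) (∣∣-nonNeg w))
    (0≤y-x⇒x≤y (resp refl (begin
      (a * d - b * c) * (a * d - b * c)
        ≈⟨ solve 4 (λ a b c d → (a :* d :- b :* c) :* (a :* d :- b :* c) :=
             (a :* a :+ b :* b) :* (c :* c :+ d :* d) :-
             (a :* c :+ b :* d) :* (a :* c :+ b :* d)) refl a b c d ⟩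
      (a * a + b * b) * (c * c + d * d) - (a * c + b * d) * (a * c + b * d)
        ≈⟨ +-congʳ (*-cong (∣∣² z) (∣∣² w)) ⟨
      (∣ z ∣ᶜ * ∣ z ∣ᶜ) * (∣ w ∣ᶜ * ∣ w ∣ᶜ) - (a * c + b * d) * (a * c + b * d)
        ≈⟨ +-congʳ (solve 2 (λ x y → (x :* x) :* (y :* y) := (x :* y) :* (x :* y)) refl
             ∣ z ∣ᶜ ∣ w ∣ᶜ) ⟩
      (∣ z ∣ᶜ * ∣ w ∣ᶜ) * (∣ z ∣ᶜ * ∣ w ∣ᶜ) - (a * c + b * d) * (a * c + b * d) ∎)
      (square-nonNeg (a * d - b * c))))

  triangle : ∀ z w → ∣ z +ᶜ w ∣ᶜ ≤ ∣ z ∣ᶜ + ∣ w ∣ᶜ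
  triangle z@(a +i b) w@(c +i d) = square-cancel-≤
    (+-nonNeg (∣∣-nonNeg z) (∣∣-nonNeg w))
    (resp (begin
      ((a * a + b * b) + (c * c + d * d)) + ((a * c + b * d) + (a * c + b * d))
        ≈⟨ solve 4 (λ a b c d →
             ((a :* a :+ b :* b) :+ (c :* c :+ d :* d)) :+ ((a :* c :+ b :* d) :+ (a :* c :+ b :* d))
             := (a :+ c) :* (a :+ c) :+ (b :+ d) :* (b :+ d)) refl a b c d ⟩
      (a + c) * (a + c) + (b + d) * (b + d)
        ≈⟨ ∣∣² (z +ᶜ w) ⟨
      ∣ z +ᶜ w ∣ᶜ * ∣ z +ᶜ w ∣ᶜ ∎)
      (begin
      ((a * a + b * b) + (c * c + d * d)) + (∣ z ∣ᶜ * ∣ w ∣ᶜ + ∣ z ∣ᶜ * ∣ w ∣ᶜ)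
        ≈⟨ +-congʳ (+-cong (∣∣² z) (∣∣² w)) ⟨
      (∣ z ∣ᶜ * ∣ z ∣ᶜ + ∣ w ∣ᶜ * ∣ w ∣ᶜ) + (∣ z ∣ᶜ * ∣ w ∣ᶜ + ∣ z ∣ᶜ * ∣ w ∣ᶜ)
        ≈⟨ solve 2 (λ x y → (x :* x :+ y :* y) :+ (x :* y :+ x :* y) := (x :+ y) :* (x :+ y)) refl
             ∣ z ∣ᶜ ∣ w ∣ᶜ ⟩
      (∣ z ∣ᶜ + ∣ w ∣ᶜ) * (∣ z ∣ᶜ + ∣ w ∣ᶜ) ∎)
      (+-mono-≤ ≤-refl (+-mono-≤ (cauchy-schwarz z w) (cauchy-schwarz z w))))

  ∣-∣ : ∀ z → ∣ (- Re z) +i (- Im z) ∣ᶜ ≈ ∣ z ∣ᶜ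
  ∣-∣ z = ∣∣-unique ((- Re z) +i (- Im z)) (∣∣-nonNeg z) (trans
    (solve 2 (λ x y → (:- x) :* (:- x) :+ (:- y) :* (:- y) := x :* x :+ y :* y) refl (Re z) (Im z))
    (sym (∣∣² z)))

  ∣x∣≤y : ∀ {x y} → 0# ≤ y → x * x ≤ y * y → ∣ x ∣ ≤ y
  ∣x∣≤y {x} 0≤y x²≤y² = ⊔-lub (square-cancel-≤ 0≤y x²≤y²)
    (square-cancel-≤ 0≤y (resp (solve 1 (λ x → x :* x := (:- x) :* (:- x)) refl x) refl x²≤y²))

  ∣Re∣≤∣∣ : ∀ z → ∣ Re z ∣ ≤ ∣ z ∣ᶜ
  ∣Re∣≤∣∣ z = ∣x∣≤y (∣∣-nonNeg z)
    (resp refl (sym (∣∣² z)) (x≤x+y (square-nonNeg (Im z))))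

-- The complex numbers as a commutative ring

module ComplexRing {c ℓ} (ℝ : RealNumbers c ℓ) where
  open RealNumbers ℝ
  open Complex ℝ
  open IntegerSolver commutativeRing

  1ᶜ : ℂ
  1ᶜ = 1# +i 0#

  -ᶜ_ : ℂ → ℂ
  -ᶜ z = (- Re z) +i (- Im z)

  private
    *ᶜ-assoc : ∀ z w v → (z *ᶜ w) *ᶜ v ≈ᶜ z *ᶜ (w *ᶜ v)
    *ᶜ-assoc (a +i b) (c +i d) (e +i f) =
      solve 6 (λ a b c d e f →
        (a :* c :- b :* d) :* e :- (a :* d :+ b :* c) :* f :=
        a :* (c :* e :- d :* f) :- b :* (c :* f :+ d :* e)) refl a b c d e f ,
      solve 6 (λ a b c d e f →
        (a :* c :- b :* d) :* f :+ (a :* d :+ b :* c) :* e :=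
        a :* (c :* f :+ d :* e) :+ b :* (c :* e :- d :* f)) refl a b c d e f

    *ᶜ-comm : ∀ z w → z *ᶜ w ≈ᶜ w *ᶜ z
    *ᶜ-comm (a +i b) (c +i d) =
      +-cong (*-comm a c) (-‿cong (*-comm b d)) ,
      solve 4 (λ a b c d → a :* d :+ b :* c := c :* b :+ d :* a) refl a b c d

    *ᶜ-identityˡ : ∀ z → 1ᶜ *ᶜ z ≈ᶜ z
    *ᶜ-identityˡ (a +i b) =
      solve 2 (λ a b → con (1 , 0) :* a :- con (0 , 0) :* b := a) refl a b ,
      solve 2 (λ a b → con (1 , 0) :* b :+ con (0 , 0) :* a := b) refl a b

    *ᶜ-identityʳ : ∀ z → z *ᶜ 1ᶜ ≈ᶜ z
    *ᶜ-identityʳ (a +i b) =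
      solve 2 (λ a b → a :* con (1 , 0) :- b :* con (0 , 0) := a) refl a b ,
      solve 2 (λ a b → a :* con (0 , 0) :+ b :* con (1 , 0) := b) refl a b

    *ᶜ-distribˡ : ∀ z w v → z *ᶜ (w +ᶜ v) ≈ᶜ z *ᶜ w +ᶜ z *ᶜ v
    *ᶜ-distribˡ (a +i b) (c +i d) (e +i f) =
      solve 6 (λ a b c d e f → a :* (c :+ e) :- b :* (d :+ f) :=
        (a :* c :- b :* d) :+ (a :* e :- b :* f)) refl a b c d e f ,
      solve 6 (λ a b c d e f → a :* (d :+ f) :+ b :* (c :+ e) :=
        (a :* d :+ b :* c) :+ (a :* f :+ b :* e)) refl a b c d e f

    *ᶜ-distribʳ : ∀ v z w → (z +ᶜ w) *ᶜ v ≈ᶜ z *ᶜ v +ᶜ w *ᶜ v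
    *ᶜ-distribʳ (e +i f) (a +i b) (c +i d) =
      solve 6 (λ a b c d e f → (a :+ c) :* e :- (b :+ d) :* f :=
        (a :* e :- b :* f) :+ (c :* e :- d :* f)) refl a b c d e f ,
      solve 6 (λ a b c d e f → (a :+ c) :* f :+ (b :+ d) :* e :=
        (a :* f :+ b :* e) :+ (c :* f :+ d :* e)) refl a b c d e f

  ℂ-commutativeRing : CommutativeRing c ℓ
  ℂ-commutativeRing = record
    { Carrier = ℂ
    ; _≈_ = _≈ᶜ_
    ; _+_ = _+ᶜ_
    ; _*_ = _*ᶜ_
    ; -_  = -ᶜ_
    ; 0#  = 0ᶜ
    ; 1#  = 1ᶜ
    ; isCommutativeRing = record
      { isRing = record
        { +-isAbelianGroup = record
          { isGroup = record
            { isMonoid = record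
              { isSemigroup = record
                { isMagma = record
                  { isEquivalence = record
                    { refl  = refl , refl
                    ; sym   = λ (p , q) → sym p , sym q
                    ; trans = λ (p , q) (r , s) → trans p r , trans q s
                    }
                  ; ∙-cong = λ (p , q) (r , s) → +-cong p r , +-cong q s
                  }
                ; assoc = λ z w v → +-assoc _ _ _ , +-assoc _ _ _
                }
              ; identity = (λ z → +-identityˡ _ , +-identityˡ _) ,
                           (λ z → +-identityʳ _ , +-identityʳ _)
              }
            ; inverse = (λ z → -‿inverseˡ _ , -‿inverseˡ _) ,
                        (λ z → -‿inverseʳ _ , -‿inverseʳ _)
            ; ⁻¹-cong = λ (p , q) → -‿cong p , -‿cong q
            }
          ; comm = λ z w → +-comm _ _ , +-comm _ _
          }
        ; *-cong = λ (p , q) (r , s) →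
            +-cong (*-cong p r) (-‿cong (*-cong q s)) , +-cong (*-cong p s) (*-cong q r)
        ; *-assoc = *ᶜ-assoc
        ; *-identity = *ᶜ-identityˡ , *ᶜ-identityʳ
        ; distrib = *ᶜ-distribˡ , *ᶜ-distribʳ
        }
      ; *-comm = *ᶜ-comm
      }
    }

-- Polynomial functions and their uniqueness

module PolynomialFunctions {c ℓ} (ℝ : RealNumbers c ℓ) where
  open Complex ℝ
  open ComplexRing ℝ
  open OrderedField ℝ using (fromℕ-∸; *-cancelˡ-≈0; 1≤⇒≰0; 1≤fromℕ)
  private module ℝ = RealNumbers ℝ
  open CommutativeRing ℂ-commutativeRing
    using (refl; sym; trans; setoid; +-cong; +-congˡ; +-congʳ; *-congˡ; *-congʳ;
           +-identityˡ; +-identityʳ; -‿inverseʳ; zeroʳ; -‿cong)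
  open IntegerSolver ℂ-commutativeRing
  open import Relation.Binary.Reasoning.Setoid setoid

  -- f is a polynomial function of degree < N, characterised by the
  -- existence of iterated divided differences.
  Poly : ℕ → (ℂ → ℂ) → Set _
  Poly zero    f = ∀ z → f z ≈ᶜ 0ᶜ
  Poly (suc N) f = ∀ a → ∃[ g ] (Poly N g × ∀ z → f z ≈ᶜ f a +ᶜ (z -ᶜ a) *ᶜ g z)

  poly-cong : ∀ N {f g} → (∀ z → f z ≈ᶜ g z) → Poly N f → Poly N g
  poly-cong zero    f≈g p z = trans (sym (f≈g z)) (p z)
  poly-cong (suc N) f≈g p a with p a
  ... | h , q , eq = h , q , λ z →
    trans (sym (f≈g z)) (trans (eq z) (+-congʳ (f≈g a)))

  poly-0 : ∀ N {f} → (∀ z → f z ≈ᶜ 0ᶜ) → Poly N f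
  poly-0 zero    f≈0 = f≈0
  poly-0 (suc N) f≈0 a = (λ _ → 0ᶜ) , poly-0 N (λ _ → refl) , λ z →
    trans (f≈0 z) (sym (trans (+-cong (f≈0 a) (zeroʳ (z -ᶜ a))) (+-identityʳ 0ᶜ)))

  poly-suc : ∀ N {f} → Poly N f → Poly (suc N) f
  poly-suc zero    p = poly-0 1 p
  poly-suc (suc N) p a with p a
  ... | g , q , eq = g , poly-suc N q , eq

  poly-const : ∀ N b → Poly (suc N) (λ _ → b)
  poly-const N b a = (λ _ → 0ᶜ) , poly-0 N (λ _ → refl) , λ z →
    sym (trans (+-congˡ (zeroʳ (z -ᶜ a))) (+-identityʳ b))

  poly-+ : ∀ N {f g} → Poly N f → Poly N g → Poly N (λ z → f z +ᶜ g z)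
  poly-+ zero    p q z = trans (+-cong (p z) (q z)) (+-identityʳ 0ᶜ)
  poly-+ (suc N) {f} {g} p q a with p a | q a
  ... | f′ , p′ , eq | g′ , q′ , eq′ = (λ z → f′ z +ᶜ g′ z) , poly-+ N p′ q′ , λ z →
    trans (+-cong (eq z) (eq′ z))
      (solve 5 (λ x y t u v → (x :+ t :* u) :+ (y :+ t :* v) := (x :+ y) :+ t :* (u :+ v))
        refl (f a) (g a) (z -ᶜ a) (f′ z) (g′ z))

  poly-*ˡ : ∀ N b {f} → Poly N f → Poly N (λ z → b *ᶜ f z)
  poly-*ˡ zero    b p z = trans (*-congˡ (p z)) (zeroʳ b)
  poly-*ˡ (suc N) b {f} p a with p a
  ... | f′ , p′ , eq = (λ z → b *ᶜ f′ z) , poly-*ˡ N b p′ , λ z →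
    trans (*-congˡ (eq z))
      (solve 4 (λ b x t u → b :* (x :+ t :* u) := b :* x :+ t :* (b :* u))
        refl b (f a) (z -ᶜ a) (f′ z))

  poly-linear : ∀ N b {f} → Poly N f → Poly (suc N) (λ z → (z -ᶜ b) *ᶜ f z)
  poly-linear zero    b p = poly-0 1 (λ z → trans (*-congˡ (p z)) (zeroʳ (z -ᶜ b)))
  poly-linear (suc N) b {f} p a with p a
  ... | f′ , p′ , eq =
    -- The product rule for divided differences at `a`.
    (λ z → (a -ᶜ b) *ᶜ f′ z +ᶜ f z) ,
    poly-+ (suc N) (poly-suc N (poly-*ˡ N (a -ᶜ b) p′)) p , λ z → (begin
    (z -ᶜ b) *ᶜ f z
      ≈⟨ solve 4 (λ z a b y → (z :- b) :* y := (a :- b) :* y :+ (z :- a) :* y) refl z a b (f z) ⟩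
    (a -ᶜ b) *ᶜ f z +ᶜ (z -ᶜ a) *ᶜ f z
      ≈⟨ +-congʳ (*-congˡ (eq z)) ⟩
    (a -ᶜ b) *ᶜ (f a +ᶜ (z -ᶜ a) *ᶜ f′ z) +ᶜ (z -ᶜ a) *ᶜ f z
      ≈⟨ solve 5 (λ s x t u y → s :* (x :+ t :* u) :+ t :* y := s :* x :+ t :* (s :* u :+ y))
           refl (a -ᶜ b) (f a) (z -ᶜ a) (f′ z) (f z) ⟩
    (a -ᶜ b) *ᶜ f a +ᶜ (z -ᶜ a) *ᶜ ((a -ᶜ b) *ᶜ f′ z +ᶜ f z) ∎)

  poly-eval : ∀ p → Poly (length p) (eval p)
  poly-eval []      = λ _ → refl
  poly-eval (b ∷ p) = poly-cong (suc (length p))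
    -- Horner's rule multiplies by z, which `poly-linear` sees as z minus 0.
    (λ z → +-congˡ (*-congʳ (solve 1 (λ z → z :- con (0 , 0) := z) refl z)))
    (poly-+ (suc (length p)) (poly-const (length p) b) (poly-linear (length p) 0ᶜ (poly-eval p)))

  poly-mono : ∀ M {N f} → Poly N f → Poly (M ℕ.+ N) f
  poly-mono zero    p = p
  poly-mono (suc M) p = poly-suc _ (poly-mono M p)

  -- The factor is real and nonzero, so it cancels in each coordinate using inverses in ℝ alone.
  fromℕᶜ-cancel : ∀ {k n w} → k < n → (fromℕᶜ n -ᶜ fromℕᶜ k) *ᶜ w ≈ᶜ 0ᶜ → w ≈ᶜ 0ᶜ
  fromℕᶜ-cancel {k} {n} {x +i y} k<n (p , q) =
    *-cancelˡ-≈0 t≉0 (ℝ.trans (ℝ.sym real) p) , *-cancelˡ-≈0 t≉0 (ℝ.trans (ℝ.sym imag) q)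
    where
    open RealNumbers ℝ using (_+_; _*_; _-_; 0#; _≈_)
    module S = IntegerSolver ℝ.commutativeRing
    t : ℝ.Carrier
    t = ℝ.fromℕ n - ℝ.fromℕ k
    t≉0 : ¬ t ≈ 0#
    t≉0 t≈0 = 1≤⇒≰0 (1≤fromℕ (ℕ.m<n⇒0<n∸m k<n))
      (ℝ.≤-reflexive (ℝ.trans (fromℕ-∸ (ℕ.<⇒≤ k<n)) t≈0))
    real : t * x - (0# - 0#) * y ≈ t * x
    real = S.solve 3 (λ t x y → t S.:* x S.:- (S.con (0 , 0) S.:- S.con (0 , 0)) S.:* y S.:= t S.:* x)
      ℝ.refl t x y
    imag : t * y + (0# - 0#) * x ≈ t * y
    imag = S.solve 3 (λ t x y → t S.:* y S.:+ (S.con (0 , 0) S.:- S.con (0 , 0)) S.:* x S.:= t S.:* y)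
      ℝ.refl t x y

  -- The divided difference at the zero `suc s` has a smaller degree bound and vanishes at all
  -- integers beyond `suc s`: the threshold rises while the degree falls.
  poly-vanishes : ∀ N s {f} → Poly N f → (∀ n → s < n → f (fromℕᶜ n) ≈ᶜ 0ᶜ) → ∀ z → f z ≈ᶜ 0ᶜ
  poly-vanishes zero    s p f≈0 = p
  poly-vanishes (suc N) s {f} p f≈0 z with p (fromℕᶜ (suc s))
  ... | g , q , eq = begin
    f z                          ≈⟨ eq z ⟩
    f a +ᶜ (z -ᶜ a) *ᶜ g z       ≈⟨ +-cong fa≈0 (*-congˡ (poly-vanishes N (suc s) q g≈0 z)) ⟩
    0ᶜ +ᶜ (z -ᶜ a) *ᶜ 0ᶜ         ≈⟨ trans (+-identityˡ _) (zeroʳ (z -ᶜ a)) ⟩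
    0ᶜ ∎
    where
    a : ℂ
    a = fromℕᶜ (suc s)
    fa≈0 : f a ≈ᶜ 0ᶜ
    fa≈0 = f≈0 (suc s) ℕ.≤-refl
    g≈0 : ∀ n → suc s < n → g (fromℕᶜ n) ≈ᶜ 0ᶜ
    g≈0 n s<n = fromℕᶜ-cancel s<n (begin
      (fromℕᶜ n -ᶜ a) *ᶜ g (fromℕᶜ n)          ≈⟨ +-identityˡ _ ⟨
      0ᶜ +ᶜ (fromℕᶜ n -ᶜ a) *ᶜ g (fromℕᶜ n)    ≈⟨ +-congʳ fa≈0 ⟨
      f a +ᶜ (fromℕᶜ n -ᶜ a) *ᶜ g (fromℕᶜ n)   ≈⟨ eq (fromℕᶜ n) ⟨
      f (fromℕᶜ n)                             ≈⟨ f≈0 n (ℕ.<⇒≤ s<n) ⟩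
      0ᶜ ∎)

  IsPolynomial : (ℂ → ℂ) → Set _
  IsPolynomial f = ∃[ N ] Poly N f

  poly-neg : ∀ N {f} → Poly N f → Poly N (λ z → -ᶜ f z)
  poly-neg zero    p z = trans (-‿cong (p z)) (trans (sym (+-identityˡ (-ᶜ 0ᶜ))) (-‿inverseʳ 0ᶜ))
  poly-neg (suc N) {f} p a with p a
  ... | f′ , p′ , eq = (λ z → -ᶜ f′ z) , poly-neg N p′ , λ z →
    trans (-‿cong (eq z))
      (solve 3 (λ x t u → :- (x :+ t :* u) := :- x :+ t :* (:- u)) refl (f a) (z -ᶜ a) (f′ z))

  isPolynomial-- : ∀ {f g} → IsPolynomial f → IsPolynomial g → IsPolynomial (λ z → f z -ᶜ g z)
  isPolynomial-- {f} {g} (M , p) (N , q) = N ℕ.+ M ,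
    poly-+ (N ℕ.+ M) {f} {λ z → -ᶜ g z} (poly-mono N {M} {f} p)
      (poly-neg (N ℕ.+ M) {g} (≡.subst (λ K → Poly K g) (ℕ.+-comm M N) (poly-mono M {N} {g} q)))

  isPolynomial-unique : ∀ {f g} s → IsPolynomial f → IsPolynomial g →
    (∀ n → s < n → f (fromℕᶜ n) ≈ᶜ g (fromℕᶜ n)) → ∀ z → f z ≈ᶜ g z
  isPolynomial-unique {f} {g} s p q f≈g z with isPolynomial-- {f} {g} p q
  ... | N , r = begin
    f z                   ≈⟨ solve 2 (λ x y → x := (x :- y) :+ y) refl (f z) (g z) ⟩
    (f z -ᶜ g z) +ᶜ g z   ≈⟨ +-congʳ (poly-vanishes N s {λ z → f z -ᶜ g z} r vanishes z) ⟩
    0ᶜ +ᶜ g z             ≈⟨ +-identityˡ (g z) ⟩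
    g z ∎
    where
    vanishes : ∀ n → s < n → f (fromℕᶜ n) -ᶜ g (fromℕᶜ n) ≈ᶜ 0ᶜ
    vanishes n s<n = trans (+-congʳ (f≈g n s<n)) (-‿inverseʳ (g (fromℕᶜ n)))

-- Estimates for the products of distances

module Products {c ℓ} (ℝ : RealNumbers c ℓ) (x : ℕ → RealNumbers.Carrier ℝ) where
  open RealNumbers ℝ
  open OrderedField ℝ
  open IntegerSolver commutativeRing

  prod : ℕ → Carrier
  prod zero    = 1#
  prod (suc k) = x k * prod k

  -- The base value is `prod 0`, so a list of n indices gives n + 1 products. It matches the
  -- constant term of modulus 1 in the expansion.
  sumProd : List ℕ → Carrier
  sumProd []      = 1#
  sumProd (i ∷ D) = prod i + sumProd D

  module _ {m} (1≤x : ∀ {k} → k < m → 1# ≤ x k) where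

    1≤prod : ∀ {k} → k ℕ.≤ m → 1# ≤ prod k
    1≤prod {zero}  _   = ≤-refl
    1≤prod {suc k} k<m = ≤-trans (1≤x k<m) (resp (*-identityʳ (x k)) refl
      (*-monoˡ-≤ (≤-trans 0≤1 (1≤x k<m)) (1≤prod (ℕ.<⇒≤ k<m))))

    0≤prod : ∀ {k} → k ℕ.≤ m → 0# ≤ prod k
    0≤prod k≤m = ≤-trans 0≤1 (1≤prod k≤m)

    prod-suc-≤ : ∀ {k ρ} → k < m → ρ ≤ x k → ρ * prod k ≤ prod (suc k)
    prod-suc-≤ k<m ρ≤x = *-monoʳ-≤ (0≤prod (ℕ.<⇒≤ k<m)) ρ≤x

    prod-mono : ∀ {i h} → i ℕ.≤ h → h ℕ.≤ m → prod i ≤ prod h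
    prod-mono {i} {zero}  z≤n _ = ≤-refl
    prod-mono {i} {suc h} i≤h h<m with ℕ.m≤n⇒m<n∨m≡n i≤h
    ... | inj₂ ≡.refl    = ≤-refl
    ... | inj₁ (s≤s i≤h) = ≤-trans (prod-mono i≤h (ℕ.<⇒≤ h<m))
      (resp (*-identityˡ (prod h)) refl (prod-suc-≤ h<m (1≤x h<m)))

    sumProd-≤-length : ∀ {h} D → Decreasing h D → h ℕ.≤ m →
                       sumProd D ≤ fromℕ (suc (length D)) * prod h
    sumProd-≤-length {h} [] _ h≤m = ≤-trans (1≤prod h≤m)
      (≤-reflexive (solve 1 (λ p → p := (con (1 , 0) :+ con (0 , 0)) :* p) refl (prod h)))
    sumProd-≤-length {h} (i ∷ D) (i<h , d) h≤m = resp refl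
      (solve 2 (λ p n → p :+ n :* p := (con (1 , 0) :+ n) :* p) refl
        (prod h) (fromℕ (suc (length D))))
      (+-mono-≤ (prod-mono (ℕ.<⇒≤ i<h) h≤m)
        (sumProd-≤-length D (decreasing-mono D (ℕ.<⇒≤ i<h) d) h≤m))

    -- Telescoping: M * prod i ≤ prod (suc i) - prod i when M + 1 ≤ x i.
    sumProd-≤-prod : ∀ {M h} → (∀ {k} → k < m → M + 1# ≤ x k) →
      ∀ D → Decreasing h D → h ℕ.≤ m → M * sumProd D + 1# ≤ prod h
    -- The extra `1#` is `prod 0`, the lower end of the telescoping sum; kept to the end, it makes
    -- the comparison strict.
    sumProd-≤-prod {M} {h} M<x [] 0<h h≤m = ≤-trans
      (resp (solve 1 (λ M → (M :+ con (1 , 0)) :* con (1 , 0) := M :* con (1 , 0) :+ con (1 , 0)) refl M)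
        refl (prod-suc-≤ 0<m (M<x 0<m)))
      (prod-mono 0<h h≤m)
      where
      0<m : 0 < m
      0<m = ℕ.≤-trans 0<h h≤m
    sumProd-≤-prod {M} {h} M<x (i ∷ D) (i<h , d) h≤m = ≤-trans
      (resp
        (solve 3 (λ M p s → M :* p :+ (M :* s :+ con (1 , 0)) := M :* (p :+ s) :+ con (1 , 0)) refl
          M (prod i) (sumProd D))
        (solve 2 (λ M p → M :* p :+ p := (M :+ con (1 , 0)) :* p) refl M (prod i))
        (+-mono-≤ (≤-refl {M * prod i}) (sumProd-≤-prod M<x D d (ℕ.<⇒≤ i<m))))
      (≤-trans (prod-suc-≤ i<m (M<x i<m)) (prod-mono i<h h≤m))
      where
      i<m : i < m
      i<m = ℕ.≤-trans i<h h≤m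

    prod-^ : ∀ {ρ j} r → 0# ≤ ρ → (∀ {k} → k < m → ρ ≤ x k) → j ℕ.+ r ℕ.≤ m →
             ρ ^ r * prod j ≤ prod (j ℕ.+ r)
    prod-^ {ρ} {j} zero    0≤ρ ρ≤x j+r≤m rewrite ℕ.+-identityʳ j = ≤-reflexive (*-identityˡ (prod j))
    prod-^ {ρ} {j} (suc r) 0≤ρ ρ≤x j+r≤m rewrite ℕ.+-suc j r = ≤-trans
      (resp (sym (*-assoc ρ (ρ ^ r) (prod j))) refl
        (*-monoˡ-≤ 0≤ρ (prod-^ r 0≤ρ ρ≤x (ℕ.<⇒≤ j+r≤m))))
      (prod-suc-≤ j+r≤m (ρ≤x j+r≤m))

    -- Strictness comes from the topmost factor alone, hence the nonzero exponent; the remaining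
    -- factors are bounded by `prod-^`.
    prod-^-strict : ∀ {ρ j} r .{{_ : NonZero r}} → 0# ≤ ρ → (∀ {k} → k < m → ¬ x k ≤ ρ) →
                    j ℕ.+ r ℕ.≤ m → ¬ prod (j ℕ.+ r) ≤ ρ ^ r * prod j
    prod-^-strict {ρ} {j} (suc r) 0≤ρ x≰ρ j+r≤m rewrite ℕ.+-suc j r = λ p →
      x≰ρ j+r≤m (*-cancelˡ-≤ (1≤⇒≰0 (1≤prod (ℕ.<⇒≤ j+r≤m)))
        (resp (*-comm _ _) (*-comm _ _) (≤-trans p
          (resp (sym (*-assoc ρ (ρ ^ r) (prod j))) refl
            (*-monoˡ-≤ 0≤ρ (prod-^ r 0≤ρ (λ k<m → ≰⇒≥ (x≰ρ k<m)) (ℕ.<⇒≤ j+r≤m)))))))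

-- The descent polynomial in falling factorials

module Expansion {c ℓ} (ℝ : RealNumbers c ℓ) where
  open RealNumbers ℝ
  open Roots ℝ using (fromℕ-nonNeg)
  open Complex ℝ
  open OrderedField ℝ
  open Modulus ℝ
  open ComplexRing ℝ
  open PolynomialFunctions ℝ
  open IntegerSolver commutativeRing
  private module ℂR = CommutativeRing ℂ-commutativeRing
  open import Relation.Binary.Reasoning.Setoid setoid

  ι : Carrier → ℂ
  ι x = x +i 0#

  ι-cong : ∀ {x y} → x ≈ y → ι x ≈ᶜ ι y
  ι-cong p = p , refl

  ι-* : ∀ x y → ι x *ᶜ ι y ≈ᶜ ι (x * y)
  ι-* x y =
    solve 2 (λ x y → x :* y :- con (0 , 0) :* con (0 , 0) := x :* y) refl x y ,
    solve 2 (λ x y → x :* con (0 , 0) :+ con (0 , 0) :* y := con (0 , 0)) refl x y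

  ι-- : ∀ x y → ι x -ᶜ ι y ≈ᶜ ι (x - y)
  ι-- x y = refl , -‿inverseʳ 0#

  falling : ℕ → ℂ → ℂ
  falling zero    z = 1ᶜ
  falling (suc k) z = (z -ᶜ fromℕᶜ k) *ᶜ falling k z

  falling-poly : ∀ k → Poly (suc k) (falling k)
  falling-poly zero    = poly-const 0 1ᶜ
  falling-poly (suc k) = poly-linear (suc k) (fromℕᶜ k) (falling-poly k)

  -- The truncated subtraction in `n P′ k` agrees with that of the field because `k ≤ n`.
  falling-fromℕ : ∀ k {n} → k ℕ.≤ n → falling k (fromℕᶜ n) ≈ᶜ fromℕᶜ (n P′ k)
  falling-fromℕ zero    {n} _   = sym (+-identityʳ 1#) , refl
  falling-fromℕ (suc k) {n} k<n = ℂR.trans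
    (ℂR.*-cong (ℂR.trans (ι-- _ _) (ι-cong (sym (fromℕ-∸ (ℕ.<⇒≤ k<n))))) (falling-fromℕ k (ℕ.<⇒≤ k<n)))
    (ℂR.trans (ι-* _ _) (ι-cong (sym (fromℕ-* (n ∸ k) (n P′ k)))))

  1≤fromℕ! : ∀ m → 1# ≤ fromℕ (m !)
  1≤fromℕ! m = 1≤fromℕ (ℕ.1≤n! m)

  fromℕ!≰0 : ∀ m → ¬ fromℕ (m !) ≤ 0#
  fromℕ!≰0 m = 1≤⇒≰0 (1≤fromℕ! m)

  -- This is d (I⁻; m) / m !, with `D` listing I⁻: the denominator of the binomial coefficient is
  -- moved here from the falling factorial.
  coefficient : ℕ → List ℕ → Carrier
  coefficient m D = fromℕ (#desc (reverse D) m) *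
    proj₁ (invertible (fromℕ (m !)) (λ eq → fromℕ!≰0 m (≤-reflexive eq)))

  coefficient-* : ∀ m D → fromℕ (m !) * coefficient m D ≈ fromℕ (#desc (reverse D) m)
  coefficient-* m D = begin
    M * (a * i)  ≈⟨ solve 3 (λ M a i → M :* (a :* i) := a :* (M :* i)) refl M a i ⟩
    a * (M * i)  ≈⟨ *-congˡ (proj₂ inverse) ⟩
    a * 1#       ≈⟨ *-identityʳ a ⟩
    a            ∎
    where
    M a i : Carrier
    M = fromℕ (m !)
    a = fromℕ (#desc (reverse D) m)
    inverse : ∃[ i ] M * i ≈ 1#
    inverse = invertible M (λ eq → fromℕ!≰0 m (≤-reflexive eq))
    i = proj₁ inverse

  coefficient-nonNeg : ∀ m D → 0# ≤ coefficient m D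
  coefficient-nonNeg m D = *-cancelˡ-≤ (fromℕ!≰0 m)
    (resp (sym (zeroʳ _)) (sym (coefficient-* m D)) (fromℕ-nonNeg (#desc (reverse D) m)))

  coefficient-≤1 : ∀ m D → coefficient m D ≤ 1#
  coefficient-≤1 m D = *-cancelˡ-≤ (fromℕ!≰0 m)
    (resp (sym (coefficient-* m D)) (sym (*-identityʳ _)) (fromℕ-mono-≤ (#desc≤n! (reverse D) m)))

  -- The descent polynomial in the falling factorial basis, from the recurrence
  -- d (I; z) = binomial z m * d (I⁻; m) - d (I⁻; z).
  expansion : List ℕ → ℂ → ℂ
  expansion []      z = 1ᶜ
  expansion (m ∷ D) z = ι (coefficient m D) *ᶜ falling m z -ᶜ expansion D z

  expansion-poly : ∀ D → IsPolynomial (expansion D)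
  expansion-poly []      = 1 , poly-const 0 1ᶜ
  expansion-poly (m ∷ D) = isPolynomial--
    (suc m , poly-*ˡ (suc m) (ι (coefficient m D)) (falling-poly m)) (expansion-poly D)

  expansion-fromℕ : ∀ {n} D → Decreasing n D →
                    expansion D (fromℕᶜ n) ≈ᶜ fromℕᶜ (#desc (reverse D) n)
  expansion-fromℕ {n} [] _ rewrite #desc-[] n = sym (+-identityʳ 1#) , refl
  expansion-fromℕ {n} (m ∷ D) (m<n , d) = ℂR.trans
    (ℂR.+-cong (ℂR.trans (ℂR.*-congˡ {ι (coefficient m D)} (falling-fromℕ m (ℕ.<⇒≤ m<n))) (ι-* _ _))
      (ℂR.-‿cong (expansion-fromℕ D (decreasing-mono D (ℕ.<⇒≤ m<n) d))))
    (ℂR.trans (ι-- _ _) (ι-cong (begin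
      α * fromℕ (n P′ m) - fromℕ b       ≈⟨ +-congʳ step ⟩
      fromℕ (a ℕ.+ b) - fromℕ b         ≈⟨ +-congʳ (fromℕ-+ a b) ⟩
      (fromℕ a + fromℕ b) - fromℕ b     ≈⟨ solve 2 (λ a b → (a :+ b) :- b := a) refl (fromℕ a) (fromℕ b) ⟩
      fromℕ a                           ∎)))
    where
    α : Carrier
    α = coefficient m D
    a b e : ℕ
    a = #desc (reverse (m ∷ D)) n
    b = #desc (reverse D) n
    e = #desc (reverse D) m
    recurrence : (a ℕ.+ b) ℕ.* m ! ≡ (n P′ m) ℕ.* e
    recurrence rewrite List.unfold-reverse m D =
      #desc-rec (decreasing⇒0< D d) m<n (decreasing⇒All< D d)
    -- Multiplying by `m !` clears the coefficient and leaves the image of the recurrence in ℕ.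
    step : α * fromℕ (n P′ m) ≈ fromℕ (a ℕ.+ b)
    step = *-cancelˡ-≈ (fromℕ!≰0 m) (begin
      fromℕ (m !) * (α * fromℕ (n P′ m))   ≈⟨ *-assoc _ _ _ ⟨
      fromℕ (m !) * α * fromℕ (n P′ m)     ≈⟨ *-congʳ (coefficient-* m D) ⟩
      fromℕ e * fromℕ (n P′ m)             ≈⟨ *-comm _ _ ⟩
      fromℕ (n P′ m) * fromℕ e             ≈⟨ fromℕ-* (n P′ m) e ⟨
      fromℕ ((n P′ m) ℕ.* e)               ≡⟨ ≡.cong fromℕ recurrence ⟨
      fromℕ ((a ℕ.+ b) ℕ.* m !)            ≈⟨ fromℕ-* (a ℕ.+ b) (m !) ⟩
      fromℕ (a ℕ.+ b) * fromℕ (m !)        ≈⟨ *-comm _ _ ⟩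
      fromℕ (m !) * fromℕ (a ℕ.+ b)        ∎)

  module _ (z : ℂ) where
    distance : ℕ → Carrier
    distance k = ∣ z -ᶜ fromℕᶜ k ∣ᶜ

    open Products ℝ distance

    ∣falling∣ : ∀ k → ∣ falling k z ∣ᶜ ≈ prod k
    ∣falling∣ zero    = ∣∣-real 0≤1
    ∣falling∣ (suc k) = trans (∣∣-* (z -ᶜ fromℕᶜ k) (falling k z)) (*-congˡ (∣falling∣ k))

    ∣leading∣ : ∀ m D → ∣ ι (coefficient m D) *ᶜ falling m z ∣ᶜ ≈ coefficient m D * prod m
    ∣leading∣ m D = trans (∣∣-* (ι (coefficient m D)) (falling m z))
      (*-cong (∣∣-real (coefficient-nonNeg m D)) (∣falling∣ m))

    ∣expansion∣≤ : ∀ D → ∣ expansion D z ∣ᶜ ≤ sumProd D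
    ∣expansion∣≤ []      = ≤-reflexive (∣∣-real 0≤1)
    ∣expansion∣≤ (m ∷ D) = ≤-trans
      (triangle (ι (coefficient m D) *ᶜ falling m z) (-ᶜ expansion D z))
      (+-mono-≤
        (resp (sym (∣leading∣ m D)) (*-identityˡ (prod m))
          (*-monoʳ-≤ (resp refl (∣falling∣ m) (∣∣-nonNeg (falling m z))) (coefficient-≤1 m D)))
        (resp (sym (∣-∣ (expansion D z))) refl (∣expansion∣≤ D)))

    -- At a root the leading term equals `expansion D z`; its coefficient times `m !` counts
    -- permutations, at least one of which exists by `#desc-pos`.
    prod≤!*sumProd : ∀ m D → Decreasing m D → expansion (m ∷ D) z ≈ᶜ 0ᶜ →
                     prod m ≤ fromℕ (m !) * sumProd D
    prod≤!*sumProd m D d root = ≤-trans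
      (resp (*-identityˡ (prod m)) refl
        (*-monoʳ-≤ (resp refl (∣falling∣ m) (∣∣-nonNeg (falling m z))) (1≤fromℕ (#desc-pos D d))))
      (resp
        (begin
          fromℕ (m !) * ∣ ι α *ᶜ falling m z ∣ᶜ       ≈⟨ *-congˡ (∣leading∣ m D) ⟩
          fromℕ (m !) * (α * prod m)                   ≈⟨ *-assoc _ _ _ ⟨
          fromℕ (m !) * α * prod m                     ≈⟨ *-congʳ (coefficient-* m D) ⟩
          fromℕ (#desc (reverse D) m) * prod m         ∎)
        refl
        (*-monoˡ-≤ (fromℕ-nonNeg (m !))
          (resp (∣∣-cong (ℂR.sym leading≈expansion)) refl (∣expansion∣≤ D))))
      where
      α : Carrier
      α = coefficient m D
      leading≈expansion : ι α *ᶜ falling m z ≈ᶜ expansion D z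
      leading≈expansion = ℂR.trans (S.solve 2 (λ x y → x S.:= (x S.:- y) S.:+ y) ℂR.refl _ _)
        (ℂR.trans (ℂR.+-congʳ root) (ℂR.+-identityˡ (expansion D z)))
        where module S = IntegerSolver ℂ-commutativeRing

-- Locating the roots

module RootLocation {c ℓ} (ℝ : RealNumbers c ℓ) where
  open RealNumbers ℝ
  open Roots ℝ
  open Complex ℝ
  open OrderedField ℝ
  open Modulus ℝ
  open ComplexRing ℝ
  open PolynomialFunctions ℝ
  open Expansion ℝ
  open IntegerSolver commutativeRing
  private module ℂR = CommutativeRing ℂ-commutativeRing
  open import Relation.Binary.Reasoning.Setoid setoid

  descentPolynomial≈expansion : ∀ I d m D → elements I ≡ reverse (m ∷ D) → max I ≡ m →
    Decreasing m D → IsDescentPolynomial I d → ∀ z → eval d z ≈ᶜ expansion (m ∷ D) z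
  descentPolynomial≈expansion I d m D eq ≡.refl dec isDescent =
    isPolynomial-unique m (length d , poly-eval d) (expansion-poly (m ∷ D)) λ n m<n →
      ℂR.trans (isDescent n m<n) (ℂR.trans
        (ℂR.reflexive (≡.cong fromℕᶜ
          (≡.trans (#permutations≡#desc I n) (≡.cong (λ E → #desc E n) eq))))
        (ℂR.sym (expansion-fromℕ (m ∷ D) (m<n , dec))))

  module _ (z : ℂ) where
    open Products ℝ (distance z)

    no-root-beyond-!+1 : ∀ m D → Decreasing m D → expansion (m ∷ D) z ≈ᶜ 0ᶜ →
      ¬ (∀ {k} → k < m → ¬ distance z k ≤ fromℕ (m !) + 1#)
    -- The two estimates of `prod m` combine to `M * sumProd D + 1# ≤ M * sumProd D`.
    no-root-beyond-!+1 m D d root far = 1≰0 (+-cancelʳ-≤ (M * sumProd D) (resp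
      (+-comm (M * sumProd D) 1#) (sym (+-identityˡ (M * sumProd D)))
      (≤-trans (sumProd-≤-prod 1≤x M<x D d ℕ.≤-refl) (prod≤!*sumProd z m D d root))))
      where
      M : Carrier
      M = fromℕ (m !)
      M<x : ∀ {k} → k < m → M + 1# ≤ distance z k
      M<x k<m = ≰⇒≥ (far k<m)
      1≤x : ∀ {k} → k < m → 1# ≤ distance z k
      1≤x k<m = ≤-trans (resp refl (+-comm 1# M) (x≤x+y (fromℕ-nonNeg (m !)))) (M<x k<m)

    no-root-beyond-power : ∀ m m⁻ L {ρ} .{{_ : NonZero (m ∸ m⁻)}} →
      Decreasing m (m⁻ ∷ L) → expansion (m ∷ m⁻ ∷ L) z ≈ᶜ 0ᶜ → 0# ≤ ρ →
      ρ ^ (m ∸ m⁻) ≈ fromℕ (m ! ℕ.* (2 ℕ.+ length L)) →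
      ¬ (∀ {k} → k < m → ¬ distance z k ≤ ρ)
    no-root-beyond-power m m⁻ L {ρ} d@(m⁻<m , d⁻) root 0≤ρ ρ^≈b far =
      prod-^-strict 1≤x (m ∸ m⁻) 0≤ρ far (ℕ.≤-reflexive m⁻+r≡m)
        (≡.subst (λ n → prod n ≤ ρ ^ (m ∸ m⁻) * prod m⁻) (≡.sym m⁻+r≡m)
          (≤-trans (prod≤!*sumProd z m (m⁻ ∷ L) d root)
            (resp refl regroup (*-monoˡ-≤ (fromℕ-nonNeg (m !))
              (+-mono-≤ ≤-refl (sumProd-≤-length 1≤x L d⁻ (ℕ.<⇒≤ m⁻<m)))))))
      where
      m⁻+r≡m : m⁻ ℕ.+ (m ∸ m⁻) ≡ m
      m⁻+r≡m = ℕ.m+[n∸m]≡n (ℕ.<⇒≤ m⁻<m)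
      -- A power of `ρ` equals a positive integer, so `ρ ≤ 1#` would still give
      -- `1# ≤ ρ ^ (m ∸ m⁻) ≤ ρ`.
      1≤ρ : 1# ≤ ρ
      1≤ρ with total 1# ρ
      ... | inj₁ 1≤ρ = 1≤ρ
      ... | inj₂ ρ≤1 = ≤-trans
        (resp refl (sym ρ^≈b) (1≤fromℕ (ℕ.*-mono-≤ (ℕ.1≤n! m) (s≤s z≤n))))
        (^-≤self (m ∸ m⁻) 0≤ρ ρ≤1)
      1≤x : ∀ {k} → k < m → 1# ≤ distance z k
      1≤x k<m = ≤-trans 1≤ρ (≰⇒≥ (far k<m))
      -- Counts the entries of `L` and the index 0. Together with m⁻ this makes `2 + length L`, the
      -- cardinality of I.
      l : Carrier
      l = fromℕ (suc (length L))
      regroup : fromℕ (m !) * (prod m⁻ + l * prod m⁻) ≈ ρ ^ (m ∸ m⁻) * prod m⁻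
      regroup = begin
        fromℕ (m !) * (prod m⁻ + l * prod m⁻)
          ≈⟨ solve 3 (λ M p l → M :* (p :+ l :* p) := M :* (con (1 , 0) :+ l) :* p) refl
               (fromℕ (m !)) (prod m⁻) l ⟩
        fromℕ (m !) * fromℕ (2 ℕ.+ length L) * prod m⁻
          ≈⟨ *-congʳ (fromℕ-* (m !) (2 ℕ.+ length L)) ⟨
        fromℕ (m ! ℕ.* (2 ℕ.+ length L)) * prod m⁻
          ≈⟨ *-congʳ ρ^≈b ⟨
        ρ ^ (m ∸ m⁻) * prod m⁻ ∎

  -- A minimum is one of its arguments, so each candidate radius can be treated alone, the root
  -- through its defining equation.
  radius-cases : ∀ I 2≤#I → let r = max I ∸ max (I ∖max) in
    radius I 2≤#I ≡ fromℕ (max I !) + 1# ⊎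
    (0# ≤ radius I 2≤#I × radius I 2≤#I ^ r ≈ fromℕ (max I ! ℕ.* # I))
  radius-cases I 2≤#I = cases (⊓-sel (fromℕ (max I !) + 1#) (root r b 0≤b))
    where
    r : ℕ
    r = max I ∸ max (I ∖max)
    b : Carrier
    b = fromℕ (max I ! ℕ.* # I)
    0≤b : 0# ≤ b
    0≤b = fromℕ-nonNeg (max I ! ℕ.* # I)
    instance
      r≢0 : NonZero r
      r≢0 = ℕ.>-nonZero (ℕ.m<n⇒0<n∸m (max∖max<max I 2≤#I))
    cases : ∀ {x} → x ≡ fromℕ (max I !) + 1# ⊎ x ≡ root r b 0≤b →
      x ≡ fromℕ (max I !) + 1# ⊎ (0# ≤ x × x ^ r ≈ b)
    cases (inj₁ p)      = inj₁ p
    cases (inj₂ ≡.refl) = inj₂ (root-nonNeg r b 0≤b , root-^ r b 0≤b)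

  no-root-beyond-radius : ∀ I 2≤#I d → IsDescentPolynomial I d → ∀ z → eval d z ≈ᶜ 0ᶜ →
    ¬ (∀ {k} → k < max I → ¬ Disc k (radius I 2≤#I) z)
  no-root-beyond-radius I 2≤#I d isDescent z root = beyond (radius-cases I 2≤#I)
    where
    m m⁻ : ℕ
    m  = max I
    m⁻ = max (I ∖max)
    instance
      r≢0 : NonZero (m ∸ m⁻)
      r≢0 = ℕ.>-nonZero (ℕ.m<n⇒0<n∸m (max∖max<max I 2≤#I))
    L : List ℕ
    L = proj₁ (reversed-elements I 2≤#I)
    eq : elements I ≡ reverse (m ∷ m⁻ ∷ L)
    eq = proj₁ (proj₂ (reversed-elements I 2≤#I))
    decreasing : Decreasing m (m⁻ ∷ L)
    decreasing = proj₂ (proj₂ (reversed-elements I 2≤#I))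
    root′ : expansion (m ∷ m⁻ ∷ L) z ≈ᶜ 0ᶜ
    root′ = ℂR.trans (ℂR.sym
      (descentPolynomial≈expansion I d m (m⁻ ∷ L) eq ≡.refl decreasing isDescent z)) root
    #I≡ : # I ≡ 2 ℕ.+ length L
    #I≡ = ≡.trans (≡.cong length eq) (List.length-reverse (m ∷ m⁻ ∷ L))
    beyond : ∀ {ρ} → ρ ≡ fromℕ (m !) + 1# ⊎ (0# ≤ ρ × ρ ^ (m ∸ m⁻) ≈ fromℕ (m ! ℕ.* # I)) →
      ¬ (∀ {k} → k < m → ¬ distance z k ≤ ρ)
    beyond (inj₁ ≡.refl)        = no-root-beyond-!+1 z m (m⁻ ∷ L) decreasing root′
    beyond (inj₂ (0≤ρ , ρ^≈b)) = no-root-beyond-power z m m⁻ L decreasing root′ 0≤ρ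
      (trans ρ^≈b (reflexive (≡.cong (λ n → fromℕ (m ! ℕ.* n)) #I≡)))

  root-in-disc : ∀ I 2≤#I d → IsDescentPolynomial I d → ∀ z → eval d z ≈ᶜ 0ᶜ →
    ∃[ k ] (k < max I × Disc k (radius I 2≤#I) z)
  root-in-disc I 2≤#I d isDescent z root =
    -- Membership in each of the finitely many discs is decidable, so the refutation that all of
    -- them are missed yields a disc.
    decidable-stable (ℕ.anyUpTo? (λ k → distance z k ≤? radius I 2≤#I) (max I)) λ none →
      no-root-beyond-radius I 2≤#I d isDescent z root λ {k} k<m near → none (k , k<m , near)

  module _ {m k ρ} z (k<m : k < m) (near : Disc k ρ z) where

    disc⇒∣z∣≤ : ∣ z ∣ᶜ ≤ (ρ + fromℕ m) - 1#
    disc⇒∣z∣≤ = ≤-trans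
      (resp (∣∣-cong {(z -ᶜ fromℕᶜ k) +ᶜ fromℕᶜ k}
          (S.solve 2 (λ z k → (z S.:- k) S.:+ k S.:= z) ℂR.refl z (fromℕᶜ k)))
        (+-congˡ (∣∣-real (fromℕ-nonNeg k)))
        (triangle (z -ᶜ fromℕᶜ k) (fromℕᶜ k)))
      -- In the field, `k<m` reads `1# + fromℕ k ≤ fromℕ m`, so 1 is added to both sides before
      -- comparing.
      (+-cancelʳ-≤ 1# (resp
        (solve 3 (λ ρ k o → ρ :+ (o :+ k) := (ρ :+ k) :+ o) refl ∣ z -ᶜ fromℕᶜ k ∣ᶜ (fromℕ k) 1#)
        (solve 2 (λ x o → x := (x :- o) :+ o) refl (ρ + fromℕ m) 1#)
        (+-mono-≤ near (fromℕ-mono-≤ k<m))))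
      where module S = IntegerSolver ℂ-commutativeRing

    -- The negative of `Re z - fromℕ k` is at most `ρ`, and the centre satisfies `0# ≤ fromℕ k`.
    disc⇒≤Re : - ρ ≤ Re z
    disc⇒≤Re = 0≤y-x⇒x≤y (resp refl
      (solve 3 (λ ρ z k → (ρ :- (:- (z :- k))) :+ k := z :- (:- ρ)) refl ρ (Re z) (fromℕ k))
      (+-nonNeg (0≤y-x (≤-trans (y≤x⊔y (Re z - fromℕ k) (- (Re z - fromℕ k)))
          (≤-trans (∣Re∣≤∣∣ (z -ᶜ fromℕᶜ k)) near)))
        (fromℕ-nonNeg k)))

    disc⇒∣Im∣≤ : ∣ Im z ∣ ≤ ρ
    disc⇒∣Im∣≤ = ≤-trans
      (∣x∣≤y (∣∣-nonNeg (z -ᶜ fromℕᶜ k)) (resp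
        (solve 1 (λ y → (y :- con (0 , 0)) :* (y :- con (0 , 0)) := y :* y) refl (Im z))
        (trans (+-comm _ _) (sym (∣∣² (z -ᶜ fromℕᶜ k))))
        (x≤x+y (square-nonNeg (Re z - fromℕ k)))))
      near

theorem4p13 :
  ∀ {c ℓ} (ℝ : RealNumbers c ℓ) →
  let open RealNumbers ℝ
      open Complex ℝ
  in
  (I : PositiveSet) (2≤#I : 2 ≤ⁿ # I) →
  (d : Polynomial) → IsDescentPolynomial I d →
  let m = max I
      ρ = radius I 2≤#I
  in
  (∀ z → eval d z ≈ᶜ 0ᶜ → ∃[ k ] (k < m × Disc k ρ z)) ×
  (∀ z₀ → eval d z₀ ≈ᶜ 0ᶜ →
    ∣ z₀ ∣ᶜ ≤ (ρ + fromℕ m) - 1# ×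
    (- ρ) ≤ Re z₀ ×
    ∣ Im z₀ ∣ ≤ ρ)
theorem4p13 ℝ I 2≤#I d isDescent = inDisc , λ z root →
  let k , k<m , near = inDisc z root
  in disc⇒∣z∣≤ z k<m near , disc⇒≤Re z k<m near , disc⇒∣Im∣≤ z k<m near
  where
  open RootLocation ℝ
  inDisc = root-in-disc I 2≤#I d isDescent
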